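{- Let $F$ be a minimally unsatisfiable clause-set and $\vec{v} = (v_1,\dots,v_n)$, $n\ge 2$, a singular tuple for $F$ with singularity-degree tuple $(m_1,\dots,m_n)$. Let $i \in \{1,\dots,n-1\}$, let $\pi$ be the permutation of $\{1,\dots,n\}$ exchanging $i$ and $i+1$ and fixing all other elements, and let $\vec{v}' := (v_{\pi(1)},\dots,v_{\pi(n)})$. When $\vec{v}'$ is a singular tuple for $F$ (i.e., $\pi$ is singularity-preserving), let $(m_1',\dots,m_n')$ be its singularity-degree tuple. Then: 1. If $\pi$ is singularity-preserving, then $m_j' = m_j$ for all $j \in \{1,\dots,n\}\setminus\{i,i+1\}$. 2. Assume $m_i \ge 2$. Then (a) $\pi$ is singularity-preserving; (b) $m_i' \le m_{i+1}+1$; (c) $m_{i+1}' \ge m_i - 1$; (d) if $m_{i+1}=1$ then $m_i' = 1$; (e) if $m_{i+1}\ge 2$ then $m_{i+1}' \ge 2$. 3. Assume $m_i = 1$. (a) If $m_{i+1} = 1$, then $\pi$ is singularity-preserving, $m_{i+1}' = 1$ and $m_i' \in \{1,2\}$. (b) If $m_{i+1} \ge 2$, then $\pi$ is singularity-preserving if and only if $v_{i+1}$ is singular for $\mathrm{DP}_{v_1,\dots,v_{i-1}}(F)$; and if $\pi$ is singularity-preserving then $m_i' \ge 2$.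
   Context: Literals are variables $v$ and complements $\overline{v}$; a clause is a finite set of literals with no complementary pair; a clause-set is a finite set of clauses; $\mathrm{ldeg}_F(x)$ is the number of clauses of $F$ containing literal $x$, and $\mathrm{vdeg}_F(v)=\mathrm{ldeg}_F(v)+\mathrm{ldeg}_F(\overline{v})$. $\mathrm{DP}_v(F) := \{C \in F : v \notin \mathrm{var}(C)\} \cup \{(C \cup D)\setminus\{v,\overline{v}\} : C, D \in F,\ C \cap \overline{D} = \{v\}\}$, and $\mathrm{DP}_{v_1,\dots,v_k}(F)$ is the result of applying $\mathrm{DP}_{v_1},\dots,\mathrm{DP}_{v_k}$ in this order ($F$ itself if $k=0$). A variable $v$ is singular for $F$ if $\min(\mathrm{ldeg}_F(v),\mathrm{ldeg}_F(\overline{v}))=1$, and $m$-singular ($m\ge1$) if moreover $\mathrm{vdeg}_F(v)-1=m$. For a minimally unsatisfiable $F$, a tuple $(v_1,\dots,v_n)$ is a singular tuple for $F$ if each $v_i$ is singular for $\mathrm{DP}_{v_1,\dots,v_{i-1}}(F)$; its singularity-degree tuple is $(m_1,\dots,m_n)$ where $v_i$ is $m_i$-singular for $\mathrm{DP}_{v_1,\dots,v_{i-1}}(F)$. A permutation $\pi$ is singularity-preserving for $F$ and $(v_1,\dots,v_n)$ if $(v_{\pi(1)},\dots,v_{\pi(n)})$ is also a singular tuple for $F$. -}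

module Defs where

open import Level using (0ℓ)
open import Data.Bool.Base using (Bool; true; false; not)
open import Data.Bool.Properties using () renaming (_≟_ to _≟ᵇ_)
open import Data.Fin.Base using (Fin; toℕ)
open import Data.Fin.Permutation using (Permutation′; _⟨$⟩ʳ_)
open import Data.List.Base
  using (List; []; _∷_; [_]; _++_; map; filter; length; take; foldl; catMaybes;
         cartesianProductWith; deduplicate)
open import Data.List.Membership.Propositional.Properties
  using (∈-filter⁺; ∈-filter⁻; ∈-++⁻; ∈-map⁺)
open import Data.List.Relation.Unary.All using (All)
open import Data.List.Relation.Unary.Any using (Any; here; there)
open import Data.Maybe.Base as Maybe using (Maybe)
open import Data.Nat.Base using (ℕ; _+_; _∸_; _≤_; _⊓_)
open import Data.Nat.Properties using () renaming (_≟_ to _≟ⁿ_)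
open import Data.Product.Base using (_×_; _,_; proj₁; proj₂; ∃)
open import Data.Product.Properties using () renaming (≡-dec to ×-≡-dec)
open import Data.Sum.Base using (inj₁; inj₂)
open import Data.Vec.Functional using (Vector; toList; rearrange)
open import Relation.Binary.Bundles using (DecSetoid)
open import Relation.Binary.Construct.Interior.Symmetric using (SymInterior; lhs≤rhs)
import Relation.Binary.Construct.Interior.Symmetric as Sym
import Relation.Binary.Construct.On as On
open import Relation.Binary.Definitions using (Decidable)
open import Relation.Binary.PropositionalEquality
  using (_≡_; refl; sym; subst)
open import Relation.Binary.PropositionalEquality.Properties
  using () renaming (decSetoid to ≡-decSetoid)
open import Relation.Nullary.Decidable using (¬?; dec⇒maybe)
open import Relation.Nullary.Negation using (¬_)

-- Finite sets over a decidable setoid are lists, two lists being identified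
-- when they have the same elements; order and repetitions are irrelevant.
module FiniteSet {c ℓ} (S : DecSetoid c ℓ) where

  open DecSetoid S using (_≟_) renaming (Carrier to A)
  open import Data.List.Membership.DecSetoid S public
    using (_∈_; _∉_; _∈?_)
  open import Data.List.Relation.Binary.Subset.DecSetoid S public
    using (_⊆_; _⊆?_)

  infix  4 _≐_ _≐?_
  infixl 7 _∩_
  infixl 6 _∪_ _∖_

  _≐_ : List A → List A → Set _
  _≐_ = SymInterior _⊆_

  _≐?_ : Decidable _≐_
  _≐?_ = Sym.decidable _⊆?_

  ≐-decSetoid : DecSetoid _ _
  ≐-decSetoid = record
    { Carrier = List A
    ; _≈_     = _≐_
    ; isDecEquivalence = record
      { isEquivalence = record
        { refl  = Sym.reflexive {R = _⊆_} λ x∈xs → x∈xs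
        ; sym   = Sym.symmetric
        ; trans = Sym.transitive {R = _⊆_} λ xs⊆ys ys⊆zs x∈xs → ys⊆zs (xs⊆ys x∈xs)
        }
      ; _≟_ = _≐?_
      }
    }

  _∩_ _∪_ _∖_ : List A → List A → List A
  xs ∩ ys = filter (_∈? ys) xs
  xs ∪ ys = xs ++ ys
  xs ∖ ys = filter (λ x → ¬? (x ∈? ys)) xs

  ∣_∣ : List A → ℕ
  ∣ xs ∣ = length (deduplicate _≟_ xs)

Var : Set
Var = ℕ

Literal : Set
Literal = Var × Bool

pattern pos v = v , true
pattern neg v = v , false

comp : Literal → Literal
comp (v , b) = v , not b

module VarSet     = FiniteSet (≡-decSetoid _≟ⁿ_)
module LiteralSet = FiniteSet (≡-decSetoid (×-≡-dec _≟ⁿ_ _≟ᵇ_))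

open LiteralSet using (_∈_; _∉_; _∈?_; _≐_; _≐?_; _∩_; _∪_; _∖_)

record Clause : Set where
  constructor clause
  field
    lits       : List Literal
    consistent : ∀ {x} → x ∈ lits → comp x ∉ lits

open Clause public

-- Clauses are compared by their literal sets only.
clauseDecSetoid : DecSetoid 0ℓ 0ℓ
clauseDecSetoid = On.decSetoid LiteralSet.≐-decSetoid lits

module ClauseFinSet = FiniteSet clauseDecSetoid

ClauseSet : Set
ClauseSet = List Clause

var : Clause → List Var
var C = map proj₁ (lits C)

Assignment : Set
Assignment = Var → Bool

SatisfiesClause : Assignment → Clause → Set
SatisfiesClause α C = Any (λ (v , b) → α v ≡ b) (lits C)

Satisfiable : ClauseSet → Set
Satisfiable F = ∃ λ α → All (SatisfiesClause α) F

MinimallyUnsatisfiable : ClauseSet → Set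
MinimallyUnsatisfiable F =
  ¬ Satisfiable F ×
  (∀ C → C ClauseFinSet.∈ F → Satisfiable (F ClauseFinSet.∖ [ C ]))

ldeg : ClauseSet → Literal → ℕ
ldeg F x = ClauseFinSet.∣ filter (λ C → x ∈? lits C) F ∣

vdeg : ClauseSet → Var → ℕ
vdeg F v = ldeg F (pos v) + ldeg F (neg v)

Resolvable : Var → Clause → Clause → Set
Resolvable v C D = lits C ∩ map comp (lits D) ≐ [ pos v ]

resolvent : ∀ v C D → Resolvable v C D → Clause
resolvent v C D r = clause R R-consistent
  where
  vs R : List Literal
  vs = pos v ∷ neg v ∷ []
  R  = (lits C ∪ lits D) ∖ vs

  comp-involutive : ∀ x → comp (comp x) ≡ x
  comp-involutive (pos _) = refl
  comp-involutive (neg _) = refl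

  clash : ∀ {x} → x ∈ lits C → comp x ∈ lits D → x ≡ pos v
  clash {x} x∈C x̄∈D
    with lhs≤rhs r (∈-filter⁺ (_∈? map comp (lits D)) x∈C
           (subst (_∈ map comp (lits D)) (comp-involutive x) (∈-map⁺ comp x̄∈D)))
  ... | here x≡v = x≡v

  R⁻ : ∀ {x} → x ∈ R → x ∈ lits C ∪ lits D × x ∉ vs
  R⁻ = ∈-filter⁻ (λ x → ¬? (x ∈? vs)) {xs = lits C ∪ lits D}

  R-consistent : ∀ {x} → x ∈ R → comp x ∉ R
  R-consistent {x} x∈R x̄∈R with R⁻ x∈R | R⁻ x̄∈R
  ... | x∈ , x∉vs | x̄∈ , x̄∉vs with ∈-++⁻ (lits C) x∈ | ∈-++⁻ (lits C) x̄∈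
  ... | inj₁ x∈C | inj₁ x̄∈C = consistent C x∈C x̄∈C
  ... | inj₂ x∈D | inj₂ x̄∈D = consistent D x∈D x̄∈D
  ... | inj₁ x∈C | inj₂ x̄∈D = x∉vs (here (clash x∈C x̄∈D))
  ... | inj₂ x∈D | inj₁ x̄∈C =
    x̄∉vs (here (clash x̄∈C (subst (_∈ lits D) (sym (comp-involutive x)) x∈D)))

resolve : Var → Clause → Clause → Maybe Clause
resolve v C D = Maybe.map (resolvent v C D)
  (dec⇒maybe (lits C ∩ map comp (lits D) ≐? [ pos v ]))

DP : Var → ClauseSet → ClauseSet
DP v F = filter (λ C → ¬? (v VarSet.∈? var C)) F
         ClauseFinSet.∪ catMaybes (cartesianProductWith (resolve v) F F)

-- The head of the list is eliminated first.
DP* : List Var → ClauseSet → ClauseSet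
DP* vs F = foldl (λ G v → DP v G) F vs

Singular : ClauseSet → Var → Set
Singular F v = ldeg F (pos v) ⊓ ldeg F (neg v) ≡ 1

_-Singular : ℕ → ClauseSet → Var → Set
(m -Singular) F v = 1 ≤ m × Singular F v × vdeg F v ∸ 1 ≡ m

-- The entries strictly before position i.
before : ∀ {n} → Vector Var n → Fin n → List Var
before v i = take (toℕ i) (toList v)

SingularTuple : ∀ {n} → ClauseSet → Vector Var n → Set
SingularTuple F v = ∀ i → Singular (DP* (before v i) F) (v i)

SingularityDegrees : ∀ {n} → ClauseSet → Vector Var n → Vector ℕ n → Set
SingularityDegrees F v m = ∀ i → (m i -Singular) (DP* (before v i) F) (v i)

permute : ∀ {n} → Permutation′ n → Vector Var n → Vector Var n
permute π = rearrange (π ⟨$⟩ʳ_)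

SingularityPreserving : ∀ {n} → ClauseSet → Vector Var n → Permutation′ n → Set
SingularityPreserving F v π = SingularTuple F (permute π v)

-- Let F be minimally unsatisfiable and C the only clause of F with the literal
-- x of the variable v. For a clause D with the complement of x, an assignment
-- satisfying F except for D makes x true and falsifies all other literals of C.
-- Hence C and D clash in x only, DP_v(F) is again minimally unsatisfiable, and
-- the resolvents are pairwise distinct and new. So passing from F to DP_v(F)
-- changes the degree of a literal y over another variable only if y ∈ C, by a
-- formula in the numbers of clauses of the two kinds containing y; all claims
-- about the entries i and i+1 are read off this formula. The other entries are
-- unaffected because eliminations of two variables that are both singular in F
-- commute.

module Submission where

open import Defs
open import Data.Bool.Base using (true; false)
open import Data.Bool.Properties using (¬-not; not-¬) renaming (_≟_ to _≟ᵇ_)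
open import Data.Fin.Base using (Fin; zero; suc; inject₁; toℕ)
open import Data.Fin.Permutation using (transpose; _⟨$⟩ʳ_)
open import Data.Fin.Properties using (suc-injective) renaming (_≟_ to _≟ᶠ_)
open import Data.List.Base
  using (List; []; _∷_; [_]; _++_; map; filter; length; take; catMaybes; deduplicate;
         cartesianProductWith)
open import Data.List.Membership.Propositional using (find; lose) renaming (_∈_ to _∈ₚ_)
open import Data.List.Membership.Propositional.Properties
  using (∈-++⁺ˡ; ∈-++⁺ʳ; ∈-++⁻; ∈-map⁺; ∈-map⁻; ∈-filter⁺; ∈-filter⁻;
         ∈-cartesianProductWith⁺; ∈-cartesianProductWith⁻)
import Data.List.Membership.Setoid.Properties as Mem
open import Data.List.Properties
  using (filter-notAll; filter-++; filter-all; length-++; length-filter; length-map; tabulate-cong)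
open import Data.List.Relation.Unary.All as All using (All; []; _∷_)
open import Data.List.Relation.Unary.AllPairs using ([]; _∷_)
open import Data.List.Relation.Unary.Any as Any using (here; there)
open import Data.List.Relation.Unary.Unique.DecSetoid.Properties using (deduplicate-!)
import Data.List.Relation.Unary.Unique.Setoid.Properties as Unique
open import Data.Maybe.Base using (just; nothing)
open import Data.Nat.Base using (ℕ; suc; _+_; _∸_; _≤_; _≥_; z≤n; s≤s; _⊓_)
open import Data.Nat.Properties
  using (≤-refl; ≤-trans; ≤-antisym; ≤-reflexive; n≤1+n; m≤m+n; m≤n+m; +-comm; +-identityʳ;
         +-mono-≤; +-monoˡ-≤; ∸-monoˡ-≤; m+n≡0⇒n≡0; ⊓-comm; ⊓-sel; m⊓n≤m; m⊓n≤n; m≤n⇒m⊓n≡m)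
  renaming (_≟_ to _≟ⁿ_)
open import Data.Product.Base as Product using (_×_; _,_; proj₁; proj₂; ∃; ∃₂)
open import Data.Product.Properties using () renaming (≡-dec to ×-≡-dec)
open import Data.Sum.Base as Sum using (_⊎_; inj₁; inj₂)
open import Data.Vec.Functional using (Vector; tail)
open import Function.Base using (_∘_; id)
open import Function.Bundles using (_⇔_; mk⇔; Equivalence)
open import Relation.Binary.Bundles using (DecSetoid)
open import Relation.Binary.Construct.Interior.Symmetric using (_,_; lhs≤rhs; rhs≤lhs)
open import Relation.Binary.Definitions
  using (DecidableEquality; Reflexive; Symmetric; Transitive; _Respects_)
open import Relation.Binary.PropositionalEquality
  using (_≡_; _≢_; refl; sym; trans; cong; cong₂; subst; subst₂; ≢-sym)
open import Relation.Nullary.Decidable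
  using (Dec; yes; no; ¬?; map′; toSum; decidable-stable; dec-true; dec-false)
open import Relation.Nullary.Negation using (¬_; contradiction)
open import Relation.Unary using (Pred) renaming (Decidable to Decidable₁)

-- Let d be the degree of the complement of x. For a literal y of C, let s of these d clauses
-- contain y, and r of the clauses that avoid the variable of x. The degree of y goes from s + r + 1
-- to d + r, where s ≤ d. If d ≥ 2, every other literal of C ends with degree at least 2, so a
-- literal that occurs once after the elimination lies outside C and occurred once before. If d = 1,
-- with D the clause containing the complement of x, the degree drops, by one, exactly for the
-- literals that C and D share. This drop is the real difficulty. It can make a variable singular
-- that was not singular in F, hence the condition in 3(b). In 3(a) the complement of a shared
-- literal keeps its degree 1, so the variable was singular in F with the opposite sign and degrees
-- 1 and 2, hence the two values. The arguments therefore follow literals with a fixed sign instead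
-- of variables. Commutation comes last, because it presupposes that both variables are singular in
-- F.

module FiniteSetProperties {c ℓ} (S : DecSetoid c ℓ) where

  open DecSetoid S using (_≈_; _≟_; setoid)
    renaming (Carrier to A; refl to ≈-refl; sym to ≈-sym; trans to ≈-trans)
  open FiniteSet S
  open import Data.List.Relation.Unary.Unique.DecSetoid S public using (Unique)

  -- Induction that deletes the head of `xs` from `ys`: the filter drops at least one entry of `ys`,
  -- and by uniqueness none that the tail of `xs` needs.
  length-⊆ : ∀ {xs} → Unique xs → ∀ {ys} → xs ⊆ ys → length xs ≤ length ys
  length-⊆ []           _ = z≤n
  length-⊆ {x ∷ xs} (x∉xs ∷ xs!) {ys} xs⊆ys =
    ≤-trans (s≤s (length-⊆ xs! xs⊆ys∖x))
            (filter-notAll (¬? ∘ (x ≟_)) ys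
              (Any.map (λ x≈y x≉y → x≉y x≈y) (xs⊆ys (here ≈-refl))))
    where
    xs⊆ys∖x : xs ⊆ filter (¬? ∘ (x ≟_)) ys
    xs⊆ys∖x {z} z∈xs =
      Mem.∈-filter⁺ setoid (¬? ∘ (x ≟_)) (λ y≈z x≉y x≈z → x≉y (≈-trans x≈z (≈-sym y≈z)))
        (xs⊆ys (there z∈xs))
        (λ x≈z → All.lookupWith (λ x≉y z≈y → x≉y (≈-trans x≈z z≈y)) x∉xs z∈xs)

  deduplicate-≐ : ∀ xs → deduplicate _≟_ xs ≐ xs
  deduplicate-≐ xs = Mem.∈-deduplicate⁻ setoid _≟_ xs
                   , Mem.∈-deduplicate⁺ setoid _≟_ (λ x≈y z≈x → ≈-trans z≈x (≈-sym x≈y))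

  -- Lets a cardinality be read off any repetition-free list with the right elements, in particular
  -- off the two lists chosen for `F` and `DP v F` in the degree count.
  ∣∣-unique : ∀ {xs ys} → Unique xs → xs ≐ ys → ∣ ys ∣ ≡ length xs
  ∣∣-unique {ys = ys} xs! xs≐ys = ≤-antisym
    (length-⊆ (deduplicate-! S ys) (λ p → rhs≤lhs xs≐ys (lhs≤rhs (deduplicate-≐ ys) p)))
    (length-⊆ xs! (λ p → rhs≤lhs (deduplicate-≐ ys) (lhs≤rhs xs≐ys p)))

  filter-≐ : ∀ {p} {P : Pred A p} (P? : Decidable₁ P) → P Respects _≈_ →
             ∀ {xs ys} → xs ≐ ys → filter P? xs ≐ filter P? ys
  filter-≐ P? resp {xs} {ys} xs≐ys = mono {xs} {ys} (lhs≤rhs xs≐ys) , mono {ys} {xs} (rhs≤lhs xs≐ys)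
    where
    mono : ∀ {xs ys} → xs ⊆ ys → filter P? xs ⊆ filter P? ys
    mono xs⊆ys p = let z∈ , Pz = Mem.∈-filter⁻ setoid P? resp p in
      Mem.∈-filter⁺ setoid P? resp (xs⊆ys z∈) Pz

-- Clauses up to equality of their literal sets

open LiteralSet using (_∈_; _∉_; _∈?_; _≐_; _≐?_; _∩_; _∪_; _∖_)
open ClauseFinSet using () renaming (_≐_ to _≐ᶜ_)
open DecSetoid clauseDecSetoid using () renaming (setoid to clauseSetoid)
open FiniteSetProperties clauseDecSetoid
open DecSetoid ClauseFinSet.≐-decSetoid using () renaming (sym to ≐ᶜ-sym; trans to ≐ᶜ-trans)

infix 4 _≈_ _∈ᶜ_ _≟ᶜ_

-- Clause equality and membership in a clause-set only mention the literals of
-- a clause; wrapping them in records lets Agda infer the clauses themselves.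
record _≈_ (C D : Clause) : Set where
  constructor equal
  field lits≐ : lits C ≐ lits D

  ⟶ : ∀ {z} → z ∈ lits C → z ∈ lits D
  ⟶ = lhs≤rhs lits≐

  ⟵ : ∀ {z} → z ∈ lits D → z ∈ lits C
  ⟵ = rhs≤lhs lits≐

open _≈_

≈-refl : Reflexive _≈_
≈-refl = equal ((λ z∈ → z∈) , (λ z∈ → z∈))

≈-sym : Symmetric _≈_
≈-sym C≈D = equal (⟵ C≈D , ⟶ C≈D)

≈-trans : Transitive _≈_
≈-trans C≈D D≈E = equal ((λ z∈ → ⟶ D≈E (⟶ C≈D z∈)) , (λ z∈ → ⟵ C≈D (⟵ D≈E z∈)))

_≟ᶜ_ : ∀ C D → Dec (C ≈ D)
C ≟ᶜ D = map′ equal lits≐ (lits C ≐? lits D)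

record _∈ᶜ_ (C : Clause) (F : ClauseSet) : Set where
  constructor member
  field ∈-raw : C ClauseFinSet.∈ F

open _∈ᶜ_

≐ᶜ⇒⊆ : ∀ {F G} → F ≐ᶜ G → ∀ {C} → C ∈ᶜ F → C ∈ᶜ G
≐ᶜ⇒⊆ F≐G {C} (member C∈F) = member (lhs≤rhs F≐G {C} C∈F)

⊆⊇⇒≐ᶜ : ∀ {F G} → (∀ {C} → C ∈ᶜ F → C ∈ᶜ G) → (∀ {C} → C ∈ᶜ G → C ∈ᶜ F) → F ≐ᶜ G
⊆⊇⇒≐ᶜ F⊆G G⊆F = (λ {C} C∈F → ∈-raw (F⊆G {C} (member C∈F)))
              , (λ {C} C∈G → ∈-raw (G⊆F {C} (member C∈G)))

∈ᶜ⇒∈ : ∀ {C F} → C ∈ᶜ F → ∃ λ D → D ∈ₚ F × C ≈ D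
∈ᶜ⇒∈ (member C∈F) with find C∈F
... | D , D∈F , C≐D = D , D∈F , equal C≐D

∈⇒∈ᶜ : ∀ {C D F} → D ∈ₚ F → C ≈ D → C ∈ᶜ F
∈⇒∈ᶜ D∈F C≈D = member (lose D∈F (lits≐ C≈D))

∈ᶜ-resp : ∀ {F} → (_∈ᶜ F) Respects _≈_
∈ᶜ-resp C≈D C∈F with ∈ᶜ⇒∈ C∈F
... | E , E∈F , C≈E = ∈⇒∈ᶜ E∈F (≈-trans (≈-sym C≈D) C≈E)

-- Literals, variables of clauses, and resolution

_≟ˡ_ : DecidableEquality Literal
_≟ˡ_ = ×-≡-dec _≟ⁿ_ _≟ᵇ_

comp-involutive : ∀ x → comp (comp x) ≡ x
comp-involutive (pos _) = refl
comp-involutive (neg _) = refl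

same-var : ∀ x z → proj₁ z ≡ proj₁ x → z ≡ x ⊎ z ≡ comp x
same-var (v , true)  (.v , true)  refl = inj₁ refl
same-var (v , true)  (.v , false) refl = inj₂ refl
same-var (v , false) (.v , true)  refl = inj₂ refl
same-var (v , false) (.v , false) refl = inj₁ refl

literal-unique : ∀ C {x z} → x ∈ lits C → z ∈ lits C → proj₁ z ≡ proj₁ x → z ≡ x
literal-unique C {x} {z} x∈C z∈C e with same-var x z e
... | inj₁ z≡x = z≡x
... | inj₂ refl = contradiction z∈C (consistent C x∈C)

record _Avoids_ (C : Clause) (v : Var) : Set where
  constructor avoiding
  field ≢-var : ∀ {z} → z ∈ lits C → proj₁ z ≢ v

open _Avoids_

avoids⁺ : ∀ {x C} → x ∉ lits C → comp x ∉ lits C → C Avoids proj₁ x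
avoids⁺ {x} x∉C x̄∉C = avoiding λ {z} z∈C e →
  Sum.[ (λ { refl → x∉C z∈C }) , (λ { refl → x̄∉C z∈C }) ]′ (same-var x z e)

contains-or-avoids : ∀ x C → x ∈ lits C ⊎ comp x ∈ lits C ⊎ C Avoids proj₁ x
contains-or-avoids x C with x ∈? lits C | comp x ∈? lits C
... | yes x∈C | _       = inj₁ x∈C
... | no  _   | yes x̄∈C = inj₂ (inj₁ x̄∈C)
... | no  x∉C | no  x̄∉C = inj₂ (inj₂ (avoids⁺ x∉C x̄∉C))

-- The sign of x is arbitrary here, whereas Resolvable wants the positive
-- literal in the left clause.
record Resolves (x : Literal) (C D R : Clause) : Set where
  field
    left   : x ∈ lits C
    right  : comp x ∈ lits D
    clash  : ∀ {z} → z ∈ lits C → comp z ∈ lits D → z ≡ x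
    fromˡ  : ∀ {z} → z ∈ lits C → proj₁ z ≢ proj₁ x → z ∈ lits R
    fromʳ  : ∀ {z} → z ∈ lits D → proj₁ z ≢ proj₁ x → z ∈ lits R
    origin : ∀ {z} → z ∈ lits R → z ∈ lits C ⊎ z ∈ lits D
    avoids : R Avoids (proj₁ x)

open Resolves

Resolves-sym : ∀ {x C D R} → Resolves x C D R → Resolves (comp x) D C R
Resolves-sym {x} {C} {D} r = record
  { left   = right r
  ; right  = subst (_∈ lits C) (sym (comp-involutive x)) (left r)
  ; clash  = λ {z} z∈D z̄∈C → trans (sym (comp-involutive z))
               (cong comp (clash r z̄∈C (subst (_∈ lits D) (sym (comp-involutive z)) z∈D)))
  ; fromˡ  = fromʳ r
  ; fromʳ  = fromˡ r
  ; origin = Sum.swap ∘ origin r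
  ; avoids = avoids r
  }

Resolves-resp : ∀ {x C C′ D D′ R R′} → C ≈ C′ → D ≈ D′ → R ≈ R′ →
                Resolves x C D R → Resolves x C′ D′ R′
Resolves-resp C≈ D≈ R≈ r = record
  { left   = ⟶ C≈ (left r)
  ; right  = ⟶ D≈ (right r)
  ; clash  = λ z∈ z̄∈ → clash r (⟵ C≈ z∈) (⟵ D≈ z̄∈)
  ; fromˡ  = λ z∈ z≢ → ⟶ R≈ (fromˡ r (⟵ C≈ z∈) z≢)
  ; fromʳ  = λ z∈ z≢ → ⟶ R≈ (fromʳ r (⟵ D≈ z∈) z≢)
  ; origin = λ z∈ → Sum.map (⟶ C≈) (⟶ D≈) (origin r (⟵ R≈ z∈))
  ; avoids = avoiding λ z∈ → ≢-var (avoids r) (⟵ R≈ z∈)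
  }

Resolves-mono : ∀ {x C D R R′} → Resolves x C D R → Resolves x C D R′ → lits R LiteralSet.⊆ lits R′
Resolves-mono r r′ z∈R with origin r z∈R
... | inj₁ z∈C = fromˡ r′ z∈C (≢-var (avoids r) z∈R)
... | inj₂ z∈D = fromʳ r′ z∈D (≢-var (avoids r) z∈R)

-- The fields of `Resolves` determine the literals of the resolvent, so the clauses built by
-- `resolvent` inside `DP` and by `resolventOn` can replace each other.
Resolves-unique : ∀ {x C D R R′} → Resolves x C D R → Resolves x C D R′ → R ≈ R′
Resolves-unique r r′ = equal (Resolves-mono r r′ , Resolves-mono r′ r)

-- Filtering out clashing literals makes the resolvent a total function; nothing
-- is removed when C and D clash in x only.
resolventOn : Literal → Clause → Clause → Clause
resolventOn x C D = clause (filter unopposed? U) λ x∈ x̄∈ →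
    let x̄∈U = proj₁ (∈-filter⁻ unopposed? {xs = U} x̄∈)
    in proj₂ (∈-filter⁻ unopposed? {xs = U} x∈) x̄∈U
  where
  U = filter (λ z → ¬? (proj₁ z ≟ⁿ proj₁ x)) (lits C ∪ lits D)
  unopposed? = λ z → ¬? (comp z ∈? U)

resolventOn-resolves : ∀ {x C D} → x ∈ lits C → comp x ∈ lits D →
  (∀ {z} → z ∈ lits C → comp z ∈ lits D → z ≡ x) →
  Resolves x C D (resolventOn x C D)
resolventOn-resolves {x} {C} {D} x∈C x̄∈D clash! = record
  { left   = x∈C
  ; right  = x̄∈D
  ; clash  = clash!
  ; fromˡ  = λ z∈ → R⁺ (∈-++⁺ˡ z∈)
  ; fromʳ  = λ z∈ → R⁺ (∈-++⁺ʳ (lits C) z∈)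
  ; origin = λ z∈ → ∈-++⁻ (lits C) (proj₁ (U⁻ (R⁻ z∈)))
  ; avoids = avoiding λ z∈ → proj₂ (U⁻ (R⁻ z∈))
  }
  where
  off? = λ (z : Literal) → ¬? (proj₁ z ≟ⁿ proj₁ x)
  U = filter off? (lits C ∪ lits D)
  U⁻ : ∀ {z} → z ∈ U → z ∈ lits C ∪ lits D × proj₁ z ≢ proj₁ x
  U⁻ = ∈-filter⁻ off? {xs = lits C ∪ lits D}
  unopposed : ∀ {z} → z ∈ U → comp z ∉ U
  unopposed {z} z∈U z̄∈U with U⁻ z∈U | U⁻ z̄∈U
  ... | z∈ , z≢ | z̄∈ , _ with ∈-++⁻ (lits C) z∈ | ∈-++⁻ (lits C) z̄∈
  ... | inj₁ z∈C | inj₁ z̄∈C = consistent C z∈C z̄∈C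
  ... | inj₂ z∈D | inj₂ z̄∈D = consistent D z∈D z̄∈D
  ... | inj₁ z∈C | inj₂ z̄∈D = z≢ (cong proj₁ (clash! z∈C z̄∈D))
  ... | inj₂ z∈D | inj₁ z̄∈C =
    z≢ (cong proj₁ (clash! z̄∈C (subst (_∈ lits D) (sym (comp-involutive z)) z∈D)))
  R⁺ : ∀ {z} → z ∈ lits C ∪ lits D → proj₁ z ≢ proj₁ x → z ∈ lits (resolventOn x C D)
  R⁺ z∈ z≢ = let z∈U = ∈-filter⁺ off? z∈ z≢ in
    ∈-filter⁺ (λ z → ¬? (comp z ∈? U)) z∈U (unopposed z∈U)
  R⁻ : ∀ {z} → z ∈ lits (resolventOn x C D) → z ∈ U
  R⁻ z∈ = proj₁ (∈-filter⁻ (λ z → ¬? (comp z ∈? U)) {xs = U} z∈)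

resolvable : ∀ {v C D R} → Resolves (pos v) C D R → Resolvable v C D
resolvable {v} {C} {D} r = to , from
  where
  to : ∀ {z} → z ∈ lits C ∩ map comp (lits D) → z ∈ [ pos v ]
  to z∈ with ∈-filter⁻ (_∈? map comp (lits D)) {xs = lits C} z∈
  ... | z∈C , z∈D̄ with ∈-map⁻ comp z∈D̄
  ... | y , y∈D , refl = here (clash r z∈C (subst (_∈ lits D) (sym (comp-involutive y)) y∈D))
  from : ∀ {z} → z ∈ [ pos v ] → z ∈ lits C ∩ map comp (lits D)
  from (here refl) = ∈-filter⁺ (_∈? map comp (lits D)) (left r) (∈-map⁺ comp (right r))

resolvent-resolves : ∀ {v C D} (r : Resolvable v C D) → Resolves (pos v) C D (resolvent v C D r)
resolvent-resolves {v} {C} {D} r = record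
  { left   = proj₁ both
  ; right  = v̄∈D (∈-map⁻ comp (proj₂ both))
  ; clash  = clash!
  ; fromˡ  = λ z∈ → R⁺ (∈-++⁺ˡ z∈)
  ; fromʳ  = λ z∈ → R⁺ (∈-++⁺ʳ (lits C) z∈)
  ; origin = λ z∈ → ∈-++⁻ (lits C) (proj₁ (R⁻ z∈))
  ; avoids = avoiding λ z∈ z≡v → proj₂ (R⁻ z∈) (vs⁺ z≡v)
  }
  where
  vs = pos v ∷ neg v ∷ []
  vs⁺ : ∀ {z} → proj₁ z ≡ v → z ∈ vs
  vs⁺ {_ , true}  refl = here refl
  vs⁺ {_ , false} refl = there (here refl)
  vs⁻ : ∀ {z} → z ∈ vs → proj₁ z ≡ v
  vs⁻ (here refl)         = refl
  vs⁻ (there (here refl)) = refl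
  R⁻ : ∀ {z} → z ∈ (lits C ∪ lits D) ∖ vs → z ∈ lits C ∪ lits D × z ∉ vs
  R⁻ = ∈-filter⁻ (λ x → ¬? (x ∈? vs)) {xs = lits C ∪ lits D}
  R⁺ : ∀ {z} → z ∈ lits C ∪ lits D → proj₁ z ≢ v → z ∈ (lits C ∪ lits D) ∖ vs
  R⁺ z∈ z≢v = ∈-filter⁺ (λ x → ¬? (x ∈? vs)) z∈ (λ z∈vs → z≢v (vs⁻ z∈vs))
  both : pos v ∈ lits C × pos v ∈ map comp (lits D)
  both = ∈-filter⁻ (_∈? map comp (lits D)) {xs = lits C} (rhs≤lhs r (here refl))
  v̄∈D : (∃ λ y → y ∈ lits D × pos v ≡ comp y) → neg v ∈ lits D
  v̄∈D ((_ , false) , y∈D , refl) = y∈D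
  clash! : ∀ {z} → z ∈ lits C → comp z ∈ lits D → z ≡ pos v
  clash! {z} z∈C z̄∈D
    with lhs≤rhs r (∈-filter⁺ (_∈? map comp (lits D)) z∈C
           (subst (_∈ map comp (lits D)) (comp-involutive z) (∈-map⁺ comp z̄∈D)))
  ... | here z≡v = z≡v

-- Membership in `DP v F`

∈-catMaybes⁺ : ∀ {c} {A : Set c} {x : A} {xs} → just x ∈ₚ xs → x ∈ₚ catMaybes xs
∈-catMaybes⁺ {xs = just _ ∷ _}  (here refl) = here refl
∈-catMaybes⁺ {xs = just _ ∷ _}  (there p)   = there (∈-catMaybes⁺ p)
∈-catMaybes⁺ {xs = nothing ∷ _} (there p)   = ∈-catMaybes⁺ p

∈-catMaybes⁻ : ∀ {c} {A : Set c} {x : A} xs → x ∈ₚ catMaybes xs → just x ∈ₚ xs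
∈-catMaybes⁻ (just _ ∷ _)   (here refl) = here refl
∈-catMaybes⁻ (just _ ∷ xs)  (there p)   = there (∈-catMaybes⁻ xs p)
∈-catMaybes⁻ (nothing ∷ xs) p           = there (∈-catMaybes⁻ xs p)

DP⁻ : ∀ {v F R} → R ∈ᶜ DP v F →
  (R ∈ᶜ F × R Avoids v) ⊎
  (∃₂ λ C D → C ∈ᶜ F × D ∈ᶜ F × Resolves (pos v) C D R)
DP⁻ {v} {F} R∈ with ∈ᶜ⇒∈ R∈
... | R′ , R′∈ , R≈R′ with ∈-++⁻ (filter (λ C → ¬? (v VarSet.∈? var C)) F) R′∈
... | inj₁ p with ∈-filter⁻ (λ C → ¬? (v VarSet.∈? var C)) {xs = F} p
...   | R′∈F , v∉R′ = inj₁ (∈⇒∈ᶜ R′∈F R≈R′ , avoiding λ z∈R z≡v →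
          v∉R′ (subst (_∈ₚ var R′) z≡v (∈-map⁺ proj₁ (⟶ R≈R′ z∈R))))
DP⁻ {v} {F} R∈ | R′ , R′∈ , R≈R′ | inj₂ p
  with ∈-cartesianProductWith⁻ (resolve v) F F (∈-catMaybes⁻ (cartesianProductWith (resolve v) F F) p)
... | C , D , C∈F , D∈F , e with lits C ∩ map comp (lits D) ≐? [ pos v ]
DP⁻ {v} {F} R∈ | R′ , R′∈ , R≈R′ | inj₂ p | C , D , C∈F , D∈F , refl | yes r =
  inj₂ (C , D , ∈⇒∈ᶜ C∈F ≈-refl , ∈⇒∈ᶜ D∈F ≈-refl ,
    Resolves-resp ≈-refl ≈-refl (≈-sym R≈R′) (resolvent-resolves r))

DP-kept : ∀ {v F R} → R ∈ᶜ F → R Avoids v → R ∈ᶜ DP v F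
DP-kept {v} {F} {R} R∈ R₀ with ∈ᶜ⇒∈ R∈
... | R′ , R′∈ , R≈R′ = ∈⇒∈ᶜ (∈-++⁺ˡ (∈-filter⁺ (λ C → ¬? (v VarSet.∈? var C)) R′∈ v∉R′)) R≈R′
  where
  v∉R′ : ¬ v ∈ₚ var R′
  v∉R′ v∈ with ∈-map⁻ proj₁ v∈
  ... | z , z∈R′ , refl = ≢-var R₀ (⟵ R≈R′ z∈R′) refl

DP-resolvent : ∀ {x F C D R} → C ∈ᶜ F → D ∈ᶜ F → Resolves x C D R → R ∈ᶜ DP (proj₁ x) F
DP-resolvent {v , false} C∈ D∈ r = DP-resolvent {v , true} D∈ C∈ (Resolves-sym r)
DP-resolvent {v , true} {F} {R = R} C∈ D∈ r with ∈ᶜ⇒∈ C∈ | ∈ᶜ⇒∈ D∈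
... | C′ , C′∈ , C≈ | D′ , D′∈ , D≈ =
  ∈⇒∈ᶜ (∈-++⁺ʳ (filter (λ C → ¬? (v VarSet.∈? var C)) F)
         (∈-catMaybes⁺ (subst (_∈ₚ cartesianProductWith (resolve v) F F) (proj₂ resolved)
           (∈-cartesianProductWith⁺ (resolve v) C′∈ D′∈))))
       (Resolves-unique r′ (resolvent-resolves (proj₁ resolved)))
  where
  r′ : Resolves (pos v) C′ D′ R
  r′ = Resolves-resp C≈ D≈ ≈-refl r
  resolved : ∃ λ (q : Resolvable v C′ D′) → resolve v C′ D′ ≡ just (resolvent v C′ D′ q)
  resolved with lits C′ ∩ map comp (lits D′) ≐? [ pos v ]
  ... | yes q = q , refl
  ... | no ¬q = contradiction (resolvable r′) ¬q

DP-mono : ∀ {v F G} → (∀ {C} → C ∈ᶜ F → C ∈ᶜ G) → ∀ {R} → R ∈ᶜ DP v F → R ∈ᶜ DP v G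
DP-mono F⊆G R∈ with DP⁻ R∈
... | inj₁ (R∈F , R₀) = DP-kept (F⊆G R∈F) R₀
... | inj₂ (C , D , C∈ , D∈ , r) = DP-resolvent (F⊆G C∈) (F⊆G D∈) r

DP-cong : ∀ {v F G} → F ≐ᶜ G → DP v F ≐ᶜ DP v G
DP-cong {v} {F} {G} F≐G =
  ⊆⊇⇒≐ᶜ (DP-mono (≐ᶜ⇒⊆ F≐G)) (DP-mono (≐ᶜ⇒⊆ {G} {F} (≐ᶜ-sym {F} {G} F≐G)))

-- Eliminations of singular variables commute

-- Degree 1 of x in a form without counting. When x and `comp x` both have degree 1, it applies to
-- either sign.
record Main (x : Literal) (C : Clause) (F : ClauseSet) : Set where
  field
    mem  : C ∈ᶜ F
    has  : x ∈ lits C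
    only : ∀ {D} → D ∈ᶜ F → x ∈ lits D → D ≈ C

open Main

-- One parent of every resolvent contains x and so is C. Placing C on the left absorbs the sign of
-- x.
DP-main⁻ : ∀ {x C F R} → Main x C F → R ∈ᶜ DP (proj₁ x) F →
  (R ∈ᶜ F × R Avoids (proj₁ x)) ⊎ (∃ λ D → D ∈ᶜ F × Resolves x C D R)
DP-main⁻ M R∈ with DP⁻ R∈
... | inj₁ kept = inj₁ kept
DP-main⁻ {v , true} M R∈ | inj₂ (P , Q , P∈ , Q∈ , r) =
  inj₂ (Q , Q∈ , Resolves-resp (only M P∈ (left r)) ≈-refl ≈-refl r)
DP-main⁻ {v , false} M R∈ | inj₂ (P , Q , P∈ , Q∈ , r) =
  inj₂ (P , P∈ , Resolves-resp (only M Q∈ (right r)) ≈-refl ≈-refl (Resolves-sym r))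

-- K′ is the y-resolvent of U and K if K contains the complement of y, and K
-- itself otherwise.
record Lifts (y : Literal) (U K K′ : Clause) : Set where
  field
    kept   : ∀ {z} → z ∈ lits K → proj₁ z ≢ proj₁ y → z ∈ lits K′
    added  : comp y ∈ lits K → ∀ {z} → z ∈ lits U → proj₁ z ≢ proj₁ y → z ∈ lits K′
    source : ∀ {z} → z ∈ lits K′ → z ∈ lits U ⊎ z ∈ lits K
    free   : K′ Avoids proj₁ y

open Lifts

lift : ∀ {y F U K} → U ∈ᶜ F → K ∈ᶜ F → y ∈ lits U → y ∉ lits K →
  (∀ {z} → z ∈ lits U → comp z ∈ lits K → z ≡ y) →
  ∃ λ K′ → K′ ∈ᶜ DP (proj₁ y) F × Lifts y U K K′
lift {y} {U = U} {K} U∈ K∈ y∈U y∉K clash! with comp y ∈? lits K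
... | no ȳ∉K = K , DP-kept K∈ w∉K , record
  { kept   = λ z∈ _ → z∈
  ; added  = λ ȳ∈K → contradiction ȳ∈K ȳ∉K
  ; source = inj₂
  ; free   = w∉K
  }
  where
  w∉K : K Avoids (proj₁ y)
  w∉K = avoids⁺ y∉K ȳ∉K
... | yes ȳ∈K = resolventOn y U K , DP-resolvent U∈ K∈ r , record
  { kept   = fromʳ r
  ; added  = λ _ → fromˡ r
  ; source = origin r
  ; free   = avoids r
  }
  where r = resolventOn-resolves {y} {U} {K} y∈U ȳ∈K clash!

-- Instead of resolving U with the v-resolvent V of C and D, one may first
-- resolve U with those of C, D that contain the complement of y.
exchange-kept : ∀ {x y F U C D V T} → proj₁ y ≢ proj₁ x →
  U ∈ᶜ F → U Avoids (proj₁ x) → C ∈ᶜ F → D ∈ᶜ F →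
  Resolves x C D V → Resolves y U V T → T ∈ᶜ DP (proj₁ x) (DP (proj₁ y) F)
exchange-kept {x} {y} {F} {U} {C} {D} {V} {T} w≢v U∈ U₀ C∈ D∈ r s
  with lift U∈ C∈ (left s) (λ y∈C → y∉V (fromˡ r y∈C w≢v))
         (λ z∈U z̄∈C → clash s z∈U (fromˡ r z̄∈C (≢-var U₀ z∈U)))
     | lift U∈ D∈ (left s) (λ y∈D → y∉V (fromʳ r y∈D w≢v))
         (λ z∈U z̄∈D → clash s z∈U (fromʳ r z̄∈D (≢-var U₀ z∈U)))
  where
  y∉V : y ∉ lits V
  y∉V y∈V = consistent V y∈V (right s)
... | C′ , C′∈ , lc | D′ , D′∈ , ld = DP-resolvent C′∈ D′∈ record
  { left   = kept lc (left r) (≢-sym w≢v)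
  ; right  = kept ld (right r) (≢-sym w≢v)
  ; clash  = clash!
  ; fromˡ  = λ z∈ z≢v → T⁺ lc z∈ z≢v (fromˡ r)
  ; fromʳ  = λ z∈ z≢v → T⁺ ld z∈ z≢v (fromʳ r)
  ; origin = T⁻
  ; avoids = avoiding λ z∈T → Sum.[ ≢-var U₀ , ≢-var (avoids r) ]′ (origin s z∈T)
  }
  where
  -- A clash between a literal of U and one of C or D is a clash of U with V, hence on the variable
  -- of y, which `C′` and `D′` avoid.
  clash! : ∀ {z} → z ∈ lits C′ → comp z ∈ lits D′ → z ≡ x
  clash! {z} z∈ z̄∈ with source lc z∈ | source ld z̄∈
  ... | inj₁ z∈U | inj₁ z̄∈U = contradiction z̄∈U (consistent U z∈U)
  ... | inj₁ z∈U | inj₂ z̄∈D =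
    contradiction (cong proj₁ (clash s z∈U (fromʳ r z̄∈D (≢-var U₀ z∈U)))) (≢-var (free lc) z∈)
  ... | inj₂ z∈C | inj₁ z̄∈U =
    contradiction (cong proj₁ (clash s z̄∈U
                    (subst (_∈ lits V) (sym (comp-involutive z)) (fromˡ r z∈C (≢-var U₀ z̄∈U)))))
                  (≢-var (free ld) z̄∈)
  ... | inj₂ z∈C | inj₂ z̄∈D = clash r z∈C z̄∈D
  T⁺ : ∀ {z K K′} → Lifts y U K K′ → z ∈ lits K′ → proj₁ z ≢ proj₁ x →
       (z ∈ lits K → proj₁ z ≢ proj₁ x → z ∈ lits V) → z ∈ lits T
  T⁺ l z∈ z≢v K⊆V with source l z∈
  ... | inj₁ z∈U = fromˡ s z∈U (≢-var (free l) z∈)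
  ... | inj₂ z∈K = fromʳ s (K⊆V z∈K z≢v) (≢-var (free l) z∈)
  T⁻ : ∀ {z} → z ∈ lits T → z ∈ lits C′ ⊎ z ∈ lits D′
  T⁻ {z} z∈T with origin s z∈T
  -- V contains `comp y`, so C or D does, and the lift of that clause has received the literals of
  -- U.
  ... | inj₁ z∈U = Sum.map (λ ȳ∈C → added lc ȳ∈C z∈U z≢w) (λ ȳ∈D → added ld ȳ∈D z∈U z≢w) (origin r (right s))
    where z≢w = ≢-var (avoids s) z∈T
  ... | inj₂ z∈V = Sum.map (λ z∈C → kept lc z∈C z≢w) (λ z∈D → kept ld z∈D z≢w) (origin r z∈V)
    where z≢w = ≢-var (avoids s) z∈T

-- U and V share the literals of C, so C avoids the variable of y, and it is
-- D and D′ that can be resolved on y.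
exchange-main : ∀ {x y F C D D′ U V T} → proj₁ y ≢ proj₁ x →
  C ∈ᶜ F → D ∈ᶜ F → D′ ∈ᶜ F →
  Resolves x C D U → Resolves x C D′ V → Resolves y U V T → T ∈ᶜ DP (proj₁ x) (DP (proj₁ y) F)
exchange-main {x} {y} {F} {C} {D} {D′} {U} {V} {T} w≢v C∈ D∈ D′∈ r r′ s =
  DP-resolvent (DP-kept C∈ C₀) (DP-resolvent D∈ D′∈ q) record
  { left   = left r
  ; right  = fromˡ q (right r) (≢-sym w≢v)
  ; clash  = λ z∈C z̄∈M → Sum.[ clash r z∈C , clash r′ z∈C ]′ (origin q z̄∈M)
  ; fromˡ  = λ z∈C z≢v → fromˡ s (fromˡ r z∈C z≢v) (≢-var C₀ z∈C)
  ; fromʳ  = λ z∈M z≢v → Sum.[ (λ z∈D → fromˡ s (fromʳ r z∈D z≢v) (≢-var (avoids q) z∈M))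
                             , (λ z∈D′ → fromʳ s (fromʳ r′ z∈D′ z≢v) (≢-var (avoids q) z∈M)) ]′
                             (origin q z∈M)
  ; origin = T⁻
  ; avoids = avoiding λ z∈T → Sum.[ ≢-var (avoids r) , ≢-var (avoids r′) ]′ (origin s z∈T)
  }
  where
  y∉C : y ∉ lits C
  y∉C y∈C = consistent V (fromˡ r′ y∈C w≢v) (right s)
  ȳ∉C : comp y ∉ lits C
  ȳ∉C ȳ∈C = consistent U (left s) (fromˡ r ȳ∈C w≢v)
  C₀ : C Avoids proj₁ y
  C₀ = avoids⁺ y∉C ȳ∉C
  y∈D : y ∈ lits D
  y∈D = Sum.[ (λ y∈C → contradiction y∈C y∉C) , id ]′ (origin r (left s))
  ȳ∈D′ : comp y ∈ lits D′
  ȳ∈D′ = Sum.[ (λ ȳ∈C → contradiction ȳ∈C ȳ∉C) , id ]′ (origin r′ (right s))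
  clash! : ∀ {z} → z ∈ lits D → comp z ∈ lits D′ → z ≡ y
  clash! {z} z∈D z̄∈D′ with proj₁ z ≟ⁿ proj₁ x
  ... | no z≢v = clash s (fromʳ r z∈D z≢v) (fromʳ r′ z̄∈D′ z≢v)
  -- The only literal of D over this variable is `comp x`, which D′ contains as well.
  ... | yes z≡v with literal-unique D (right r) z∈D z≡v
  ...   | refl = contradiction z̄∈D′ (consistent D′ (right r′))
  q : Resolves y D D′ (resolventOn y D D′)
  q = resolventOn-resolves y∈D ȳ∈D′ clash!
  T⁻ : ∀ {z} → z ∈ lits T → z ∈ lits C ⊎ z ∈ lits (resolventOn y D D′)
  T⁻ {z} z∈T with origin s z∈T
  ... | inj₁ z∈U = Sum.map₂ (λ z∈D → fromˡ q z∈D (≢-var (avoids s) z∈T)) (origin r z∈U)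
  ... | inj₂ z∈V = Sum.map₂ (λ z∈D′ → fromʳ q z∈D′ (≢-var (avoids s) z∈T)) (origin r′ z∈V)

-- Two resolvents on the first variable have four parents in general; here C is a parent of both,
-- and the remaining three clauses can be resolved in the other order. The argument uses the main
-- clause of the variable eliminated first, so the two inclusions of `DP-comm` use one main clause
-- each.
DP-exchange : ∀ {x w F C T} → w ≢ proj₁ x → Main x C F →
  T ∈ᶜ DP w (DP (proj₁ x) F) → T ∈ᶜ DP (proj₁ x) (DP w F)
DP-exchange {x} {w} {F} {C} {T} w≢v M T∈ with DP⁻ T∈
... | inj₁ (T∈′ , T₀) with DP-main⁻ M T∈′
...   | inj₁ (T∈F , T₁) = DP-kept (DP-kept T∈F T₀) T₁
...   | inj₂ (D , D∈ , r) = DP-resolvent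
          (DP-kept (mem M) (avoiding λ z∈C z≡w → ≢-var T₀ (fromˡ r z∈C (w≢ z≡w)) z≡w))
          (DP-kept D∈ (avoiding λ z∈D z≡w → ≢-var T₀ (fromʳ r z∈D (w≢ z≡w)) z≡w))
          r
  where
  w≢ : ∀ {u} → u ≡ w → u ≢ proj₁ x
  w≢ refl = w≢v
DP-exchange w≢v M T∈ | inj₂ (U , V , U∈ , V∈ , s) with DP-main⁻ M U∈ | DP-main⁻ M V∈
... | inj₁ (U∈F , U₀) | inj₁ (V∈F , V₀) =
  DP-kept (DP-resolvent U∈F V∈F s) (avoiding λ z∈T → Sum.[ ≢-var U₀ , ≢-var V₀ ]′ (origin s z∈T))
... | inj₁ (U∈F , U₀) | inj₂ (D , D∈ , r) = exchange-kept w≢v U∈F U₀ (mem M) D∈ r s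
... | inj₂ (D , D∈ , r) | inj₁ (V∈F , V₀) = exchange-kept w≢v V∈F V₀ (mem M) D∈ r (Resolves-sym s)
... | inj₂ (D , D∈ , r) | inj₂ (D′ , D′∈ , r′) = exchange-main w≢v (mem M) D∈ D′∈ r r′ s

DP-comm : ∀ {x y F C E} → proj₁ x ≢ proj₁ y → Main x C F → Main y E F →
  DP (proj₁ y) (DP (proj₁ x) F) ≐ᶜ DP (proj₁ x) (DP (proj₁ y) F)
DP-comm v≢w M N = ⊆⊇⇒≐ᶜ (DP-exchange (≢-sym v≢w) M) (DP-exchange v≢w N)

-- Elimination preserves minimal unsatisfiability

record True (α : Assignment) (x : Literal) : Set where
  constructor holds
  field value : α (proj₁ x) ≡ proj₂ x

True-comp : ∀ {α x} → ¬ True α x → True α (comp x)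
True-comp ¬αx = holds (¬-not (¬αx ∘ holds))

True-consistent : ∀ {α x} → True α x → ¬ True α (comp x)
True-consistent {x = x} (holds αx) (holds αx̄) = not-¬ {proj₂ x} refl (trans (sym αx) αx̄)

infix 4 _⊨_

record _⊨_ (α : Assignment) (C : Clause) : Set where
  constructor satisfied
  field
    {witness} : Literal
    inClause  : witness ∈ lits C
    isTrue    : True α witness

⊨⇒SatisfiesClause : ∀ {α C} → α ⊨ C → SatisfiesClause α C
⊨⇒SatisfiesClause (satisfied z∈C (holds αz)) = lose z∈C αz

SatisfiesClause⇒⊨ : ∀ {α C} → SatisfiesClause α C → α ⊨ C
SatisfiesClause⇒⊨ s = let _ , z∈C , αz = find s in satisfied z∈C (holds αz)

⊨-resp : ∀ {α} → (α ⊨_) Respects _≈_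
⊨-resp C≈D (satisfied z∈C αz) = satisfied (⟶ C≈D z∈C) αz

_⟦_⟧ : Assignment → Literal → Assignment
(α ⟦ v , b ⟧) u with u ≟ⁿ v
... | yes _ = b
... | no  _ = α u

⟦⟧-true : ∀ {α} x → True (α ⟦ x ⟧) x
⟦⟧-true {α} (v , b) = holds eq
  where
  eq : (α ⟦ v , b ⟧) v ≡ b
  eq with v ≟ⁿ v
  ... | yes _  = refl
  ... | no v≢v = contradiction refl v≢v

⟦⟧-keeps : ∀ {α} x {z} → z ≢ comp x → True α z → True (α ⟦ x ⟧) z
⟦⟧-keeps {α} x {z} z≢x̄ (holds αz) = holds eq
  where
  eq : (α ⟦ x ⟧) (proj₁ z) ≡ proj₂ z
  eq with proj₁ z ≟ⁿ proj₁ x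
  ... | no _ = αz
  ... | yes e with same-var x z e
  ...   | inj₁ refl = refl
  ...   | inj₂ z≡x̄  = contradiction z≡x̄ z≢x̄

side-sound : ∀ {α x C D R} → Resolves x C D R → True α x → α ⊨ D → α ⊨ R
side-sound {α} {x} {D = D} r αx (satisfied {z} z∈D αz) = satisfied (fromʳ r z∈D z≢v) αz
  where
  z≢v : proj₁ z ≢ proj₁ x
  z≢v e with literal-unique D (right r) z∈D e
  ... | refl = True-consistent {x = x} αx αz

resolvent-sound : ∀ {α x C D R} → Resolves x C D R → α ⊨ C → α ⊨ D → α ⊨ R
resolvent-sound {x = x} {C} r (satisfied {z} z∈C αz) α⊨D with proj₁ z ≟ⁿ proj₁ x
... | no z≢v = satisfied (fromˡ r z∈C z≢v) αz
... | yes e with literal-unique C (left r) z∈C e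
...   | refl = side-sound r αz α⊨D

record Critical (F : ClauseSet) (D : Clause) (α : Assignment) : Set where
  field
    rest   : ∀ {E} → E ∈ᶜ F → ¬ E ≈ D → α ⊨ E
    misses : ¬ α ⊨ D

open Critical

critical : ∀ {F D} → MinimallyUnsatisfiable F → D ∈ᶜ F → ∃ (Critical F D)
critical {F} {D} (unsat , minimal) D∈F = α , record
  { rest   = rest!
  ; misses = λ α⊨D →
      unsat (α , All.tabulate λ E∈F → ⊨⇒SatisfiesClause (sat α⊨D (∈⇒∈ᶜ E∈F ≈-refl)))
  }
  where
  α = proj₁ (minimal D (∈-raw D∈F))
  rest! : ∀ {E} → E ∈ᶜ F → ¬ E ≈ D → α ⊨ E
  rest! E∈F E≉D with ∈ᶜ⇒∈ E∈F
  ... | E′ , E′∈F , E≈E′ = ⊨-resp (≈-sym E≈E′) (SatisfiesClause⇒⊨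
    (All.lookup (proj₂ (minimal D (∈-raw D∈F)))
      (∈-filter⁺ (λ C → ¬? (C ClauseFinSet.∈? [ D ])) E′∈F
        λ { (here E′≐D) → E≉D (≈-trans E≈E′ (equal E′≐D)) })))
  sat : α ⊨ D → ∀ {E} → E ∈ᶜ F → α ⊨ E
  sat α⊨D {E} E∈F with E ≟ᶜ D
  ... | yes E≈D = ⊨-resp (≈-sym E≈D) α⊨D
  ... | no  E≉D = rest! E∈F E≉D

minimallyUnsatisfiable : ∀ {F} → (∀ α → ¬ (∀ {C} → C ∈ᶜ F → α ⊨ C)) →
  (∀ {C} → C ∈ᶜ F → ∃ λ α → ∀ {D} → D ∈ᶜ F → ¬ D ≈ C → α ⊨ D) → MinimallyUnsatisfiable F
minimallyUnsatisfiable {F} unsat minimal =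
  (λ { (α , α⊨F) → unsat α λ C∈F → let _ , D∈F , C≈D = ∈ᶜ⇒∈ C∈F in
         ⊨-resp (≈-sym C≈D) (SatisfiesClause⇒⊨ (All.lookup α⊨F D∈F)) }) ,
  λ C C∈F → let α , sat = minimal (member {C} C∈F) in
    α , All.tabulate λ D∈ →
      let D∈F , D∉C = ∈-filter⁻ (λ D → ¬? (D ClauseFinSet.∈? [ C ])) {xs = F} D∈ in
      ⊨⇒SatisfiesClause (sat (∈⇒∈ᶜ D∈F ≈-refl) (λ D≈C → D∉C (here (lits≐ D≈C))))

module _ {F x C} (F-mu : MinimallyUnsatisfiable F) (M : Main x C F) where

  private
    v = proj₁ x

  module _ {D α} (x̄∈D : comp x ∈ lits D) (crit : Critical F D α) where

    critical-x : True α x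
    critical-x = subst (True α) (comp-involutive x)
      (True-comp {x = comp x} λ αx̄ → misses crit (satisfied x̄∈D αx̄))

    -- Otherwise making x false in α would satisfy D and keep every other clause
    -- satisfied, since x occurs in C only.
    critical-main : ∀ {z} → z ∈ lits C → z ≢ x → ¬ True α z
    critical-main {z} z∈C z≢x αz = proj₁ F-mu
      (α ⟦ comp x ⟧ , All.tabulate λ E∈F → ⊨⇒SatisfiesClause (sat (∈⇒∈ᶜ E∈F ≈-refl)))
      where
      keeps : ∀ {z} → z ≢ x → True α z → True (α ⟦ comp x ⟧) z
      keeps z≢x = ⟦⟧-keeps (comp x) (λ z≡ → z≢x (trans z≡ (comp-involutive x)))
      sat : ∀ {E} → E ∈ᶜ F → α ⟦ comp x ⟧ ⊨ E
      sat {E} E∈F with E ≟ᶜ D | E ≟ᶜ C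
      ... | yes E≈D | _       = satisfied (⟵ E≈D x̄∈D) (⟦⟧-true (comp x))
      ... | no _    | yes E≈C = satisfied (⟵ E≈C z∈C) (keeps z≢x αz)
      ... | no E≉D  | no E≉C  with rest crit E∈F E≉D
      ...   | satisfied u∈E αu = satisfied u∈E (keeps (λ { refl → E≉C (only M E∈F u∈E) }) αu)

    critical-resolvent : ∀ {R} → Resolves x C D R → ¬ α ⊨ R
    critical-resolvent r (satisfied z∈R αz) with origin r z∈R
    ... | inj₁ z∈C = critical-main z∈C (λ { refl → ≢-var (avoids r) z∈R refl }) αz
    ... | inj₂ z∈D = misses crit (satisfied z∈D αz)

  -- An assignment critical for D falsifies `comp z`, so makes z true, whereas by `critical-main` it
  -- falsifies every literal of C except x.
  clash-only : ∀ {D} → D ∈ᶜ F → comp x ∈ lits D → ∀ {z} → z ∈ lits C → comp z ∈ lits D → z ≡ x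
  clash-only D∈F x̄∈D {z} z∈C z̄∈D = decidable-stable (z ≟ˡ x) λ z≢x →
    let α , crit = critical F-mu D∈F in
    misses crit (satisfied z̄∈D (True-comp {x = z} (critical-main x̄∈D crit z∈C z≢x)))

  main-resolves : ∀ {D} → D ∈ᶜ F → comp x ∈ lits D → Resolves x C D (resolventOn x C D)
  main-resolves D∈F x̄∈D = resolventOn-resolves (has M) x̄∈D (clash-only D∈F x̄∈D)

  -- An assignment critical for D falsifies the resolvent with D. It makes x true and satisfies
  -- every other side, hence also the resolvent with that side.
  resolvent≈⇒side≈ : ∀ {D R D′ R′} → D ∈ᶜ F → D′ ∈ᶜ F → Resolves x C D R → Resolves x C D′ R′ →
                     R ≈ R′ → D ≈ D′
  resolvent≈⇒side≈ {D} {D′ = D′} D∈F D′∈F r r′ R≈R′ = decidable-stable (D ≟ᶜ D′) λ D≉D′ →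
    let α , crit = critical F-mu D∈F
        x̄∈D      = right r
    in critical-resolvent x̄∈D crit r
         (⊨-resp (≈-sym R≈R′) (side-sound r′ (critical-x x̄∈D crit) (rest crit D′∈F (D≉D′ ∘ ≈-sym))))

  -- An assignment critical for D falsifies R but satisfies every clause of F other than D, and R is
  -- not D because it avoids the variable of x.
  resolvent-fresh : ∀ {D R} → D ∈ᶜ F → Resolves x C D R → ¬ R ∈ᶜ F
  resolvent-fresh D∈F r R∈F =
    let α , crit = critical F-mu D∈F in
    critical-resolvent (right r) crit r
      (rest crit R∈F λ R≈D → ≢-var (avoids r) (⟵ R≈D (right r)) refl)

  -- A model of DP v F satisfies C without x, and then x can be made false, or
  -- every clause D containing comp x without that literal, and then x can be
  -- made true.
  DP-unsatisfiable : ∀ β → ¬ (∀ {R} → R ∈ᶜ DP v F → β ⊨ R)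
  DP-unsatisfiable β β⊨DP = unsat (β ⟦ x ⟧) sat₁
    where
    unsat : ∀ γ → ¬ (∀ {E} → E ∈ᶜ F → γ ⊨ E)
    unsat γ γ⊨F = proj₁ F-mu (γ , All.tabulate λ E∈F → ⊨⇒SatisfiesClause (γ⊨F (∈⇒∈ᶜ E∈F ≈-refl)))
    main-false : ∀ {z} → z ∈ lits C → z ≢ x → ¬ True β z
    main-false {z} z∈C z≢x βz = unsat (β ⟦ comp x ⟧) sat
      where
      keeps : ∀ {z} → z ≢ x → True β z → True (β ⟦ comp x ⟧) z
      keeps z≢x = ⟦⟧-keeps (comp x) (λ z≡ → z≢x (trans z≡ (comp-involutive x)))
      sat : ∀ {E} → E ∈ᶜ F → β ⟦ comp x ⟧ ⊨ E
      sat {E} E∈F with contains-or-avoids x E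
      ... | inj₁ x∈E = satisfied (⟵ (only M E∈F x∈E) z∈C) (keeps z≢x βz)
      ... | inj₂ (inj₁ x̄∈E) = satisfied x̄∈E (⟦⟧-true (comp x))
      ... | inj₂ (inj₂ E₀) with β⊨DP (DP-kept E∈F E₀)
      ...   | satisfied u∈E βu = satisfied u∈E (keeps (λ { refl → ≢-var E₀ u∈E refl }) βu)
    sat₁ : ∀ {E} → E ∈ᶜ F → β ⟦ x ⟧ ⊨ E
    sat₁ {E} E∈F with contains-or-avoids x E
    ... | inj₁ x∈E = satisfied x∈E (⟦⟧-true x)
    ... | inj₂ (inj₂ E₀) with β⊨DP (DP-kept E∈F E₀)
    ...   | satisfied u∈E βu = satisfied u∈E (⟦⟧-keeps x (λ { refl → ≢-var E₀ u∈E refl }) βu)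
    sat₁ {E} E∈F | inj₂ (inj₁ x̄∈E) with main-resolves E∈F x̄∈E
    ... | r with β⊨DP (DP-resolvent (mem M) E∈F r)
    ...   | satisfied u∈R βu with origin r u∈R
    ...     | inj₁ u∈C = contradiction βu (main-false u∈C λ { refl → ≢-var (avoids r) u∈R refl })
    ...     | inj₂ u∈E = satisfied u∈E (⟦⟧-keeps x (λ { refl → ≢-var (avoids r) u∈R refl }) βu)

  -- For a kept clause E, an assignment critical for E satisfies both parents of every resolvent.
  -- For a resolvent of C and D, one critical for D works: x is true in it, so every other resolvent
  -- is satisfied through its side parent.
  DP-minimal : ∀ {E} → E ∈ᶜ DP v F → ∃ λ α → ∀ {R} → R ∈ᶜ DP v F → ¬ R ≈ E → α ⊨ R
  DP-minimal {E} E∈ with DP-main⁻ M E∈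
  ... | inj₁ (E∈F , E₀) = α , sat
    where
    α = proj₁ (critical F-mu E∈F)
    crit = proj₂ (critical F-mu E∈F)
    sat : ∀ {R} → R ∈ᶜ DP v F → ¬ R ≈ E → α ⊨ R
    sat R∈ R≉E with DP-main⁻ M R∈
    ... | inj₁ (R∈F , _) = rest crit R∈F R≉E
    ... | inj₂ (D , D∈F , r) = resolvent-sound r
      (rest crit (mem M) λ C≈E → ≢-var E₀ (⟶ C≈E (has M)) refl)
      (rest crit D∈F λ D≈E → ≢-var E₀ (⟶ D≈E (right r)) refl)
  ... | inj₂ (D , D∈F , r) = α , sat
    where
    α = proj₁ (critical F-mu D∈F)
    crit = proj₂ (critical F-mu D∈F)
    sat : ∀ {R} → R ∈ᶜ DP v F → ¬ R ≈ E → α ⊨ R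
    sat R∈ R≉E with DP-main⁻ M R∈
    ... | inj₁ (R∈F , R₀) = rest crit R∈F λ R≈D → ≢-var R₀ (⟵ R≈D (right r)) refl
    ... | inj₂ (D′ , D′∈F , r′) = side-sound r′ (critical-x (right r) crit)
      (rest crit D′∈F λ D′≈D → R≉E (Resolves-unique (Resolves-resp ≈-refl D′≈D ≈-refl r′) r))

  DP-minimallyUnsatisfiable : MinimallyUnsatisfiable (DP v F)
  DP-minimallyUnsatisfiable = minimallyUnsatisfiable DP-unsatisfiable DP-minimal

-- Literal degrees under elimination

avoids? : ∀ v C → Dec (C Avoids v)
avoids? v C = map′ (λ all → avoiding (All.lookup all)) (λ C₀ → All.tabulate (≢-var C₀))
  (All.all? (λ z → ¬? (proj₁ z ≟ⁿ v)) (lits C))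

count : Literal → List Clause → ℕ
count y L = length (filter (λ C → y ∈? lits C) L)

count-∋ : ∀ {y} C L → y ∈ lits C → count y (C ∷ L) ≡ suc (count y L)
count-∋ {y} C L y∈C with y ∈? lits C
... | yes _  = refl
... | no y∉C = contradiction y∈C y∉C

count-∌ : ∀ {y} C L → y ∉ lits C → count y (C ∷ L) ≡ count y L
count-∌ {y} C L y∉C with y ∈? lits C
... | yes y∈C = contradiction y∈C y∉C
... | no _    = refl

count-++ : ∀ y L M → count y (L ++ M) ≡ count y L + count y M
count-++ y L M = trans (cong length (filter-++ (λ C → y ∈? lits C) L M))
                       (length-++ (filter (λ C → y ∈? lits C) L))

count-map : ∀ {y f L} → All (λ D → (y ∈ lits D → y ∈ lits (f D)) × (y ∈ lits (f D) → y ∈ lits D)) L →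
            count y (map f L) ≡ count y L
count-map []                            = refl
count-map {y} {f} {D ∷ L} ((to , from) ∷ L~fL) with y ∈? lits D | y ∈? lits (f D)
... | yes _   | yes _    = cong suc (count-map L~fL)
... | no _    | no _     = count-map L~fL
... | yes y∈D | no y∉fD  = contradiction (to y∈D) y∉fD
... | no y∉D  | yes y∈fD = contradiction (from y∈fD) y∉D

ldeg-unique : ∀ {L F} y → Unique L → L ≐ᶜ F → ldeg F y ≡ count y L
ldeg-unique {L} {F} y L! L≐F = ∣∣-unique (Unique.filter⁺ clauseSetoid (λ C → y ∈? lits C) L!)
  (filter-≐ (λ C → y ∈? lits C) (λ C≐D y∈C → lhs≤rhs C≐D y∈C) {L} {F} L≐F)

distinct : ClauseSet → List Clause
distinct = deduplicate (DecSetoid._≟_ clauseDecSetoid)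

distinct-! : ∀ F → Unique (distinct F)
distinct-! = deduplicate-! clauseDecSetoid

∈-distinct⁻ : ∀ F {C} → C ∈ₚ distinct F → C ∈ᶜ F
∈-distinct⁻ F C∈ = ≐ᶜ⇒⊆ {distinct F} {F} (deduplicate-≐ F) (∈⇒∈ᶜ C∈ ≈-refl)

∈-distinct⁺ : ∀ F {C} → C ∈ᶜ F → ∃ λ D → D ∈ₚ distinct F × C ≈ D
∈-distinct⁺ F C∈F = ∈ᶜ⇒∈ (≐ᶜ⇒⊆ {F} {distinct F} (≐ᶜ-sym {distinct F} {F} (deduplicate-≐ F)) C∈F)

ldeg-distinct : ∀ F y → ldeg F y ≡ count y (distinct F)
ldeg-distinct F y = ldeg-unique {F = F} y (distinct-! F) (deduplicate-≐ F)

ldeg-cong : ∀ {F G} y → F ≐ᶜ G → ldeg F y ≡ ldeg G y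
ldeg-cong {F} {G} y F≐G = trans (ldeg-distinct F y)
  (sym (ldeg-unique {F = G} y (distinct-! F) (≐ᶜ-trans {distinct F} {F} {G} (deduplicate-≐ F) F≐G)))

-- Comparing applications of ldeg by unfolding them is infeasible, hence the
-- opaque copy.
opaque
  degree : ClauseSet → Literal → ℕ
  degree = ldeg

  degree≡ldeg : ∀ F y → degree F y ≡ ldeg F y
  degree≡ldeg _ _ = refl

  degree≡1⇒Main : ∀ F y → degree F y ≡ 1 → ∃ λ C → Main y C F
  degree≡1⇒Main F y eq
    with filter (λ C → y ∈? lits C) (distinct F) in e | trans (sym (ldeg-distinct F y)) eq
  ... | C ∷ [] | refl = C , record
    { mem  = ∈-distinct⁻ F (proj₁ C∈)
    ; has  = proj₂ C∈
    ; only = only!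
    }
    where
    C∈ : C ∈ₚ distinct F × y ∈ lits C
    C∈ = ∈-filter⁻ (λ C → y ∈? lits C) {xs = distinct F} (subst (C ∈ₚ_) (sym e) (here refl))
    only! : ∀ {D} → D ∈ᶜ F → y ∈ lits D → D ≈ C
    only! D∈F y∈D with ∈-distinct⁺ F D∈F
    ... | D′ , D′∈ , D≈D′ with subst (D′ ∈ₚ_) e (∈-filter⁺ (λ C → y ∈? lits C) D′∈ (⟶ D≈D′ y∈D))
    ...   | here refl = D≈D′

-- sides counts the clauses with comp x and y, others those with y that avoid
-- the variable of x. If y ∈ C then all resolvents with C contain y.
record Degrees (x : Literal) (C : Clause) (F : ClauseSet) (y : Literal) : Set where
  private H = DP (proj₁ x) F
  field
    sides others : ℕ
    sides≤ : sides ≤ degree F (comp x)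
    main∋  : y ∈ lits C → degree F y ≡ suc (sides + others) × degree H y ≡ degree F (comp x) + others
    main∌  : y ∉ lits C → degree F y ≡ sides + others × degree H y ≡ sides + others

module _ {F x C} (F-mu : MinimallyUnsatisfiable F) (M : Main x C F) where

  private
    v = proj₁ x

    -- Repetition-free lists for `F` and `DP v F` that share `Rest` and match `Side` entry by entry
    -- with the resolvents. Comparing the counts in the two lists gives the degree formula.
    Side Rest before-DP after-DP : List Clause
    Side = filter (λ D → comp x ∈? lits D) (distinct F)
    Rest = filter (avoids? v) (distinct F)
    before-DP = C ∷ Side ++ Rest
    after-DP = map (resolventOn x C) Side ++ Rest

    Side⁻ : ∀ {D} → D ∈ₚ Side → D ∈ᶜ F × comp x ∈ lits D
    Side⁻ D∈ = let D∈F , x̄∈D = ∈-filter⁻ (λ D → comp x ∈? lits D) {xs = distinct F} D∈ in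
      ∈-distinct⁻ F D∈F , x̄∈D

    Rest⁻ : ∀ {D} → D ∈ₚ Rest → D ∈ᶜ F × D Avoids v
    Rest⁻ D∈ = let D∈F , D₀ = ∈-filter⁻ (avoids? v) {xs = distinct F} D∈ in
      ∈-distinct⁻ F D∈F , D₀

    Side⁺ : ∀ {D} → D ∈ᶜ F → comp x ∈ lits D → D ∈ᶜ Side
    Side⁺ D∈F x̄∈D with ∈-distinct⁺ F D∈F
    ... | D′ , D′∈ , D≈D′ = ∈⇒∈ᶜ (∈-filter⁺ (λ D → comp x ∈? lits D) D′∈ (⟶ D≈D′ x̄∈D)) D≈D′

    Rest⁺ : ∀ {D} → D ∈ᶜ F → D Avoids v → D ∈ᶜ Rest
    Rest⁺ D∈F D₀ with ∈-distinct⁺ F D∈F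
    ... | D′ , D′∈ , D≈D′ = ∈⇒∈ᶜ (∈-filter⁺ (avoids? v) D′∈ (avoiding (≢-var D₀ ∘ ⟵ D≈D′))) D≈D′

    Side-resolves : ∀ {D} → D ∈ₚ Side → Resolves x C D (resolventOn x C D)
    Side-resolves D∈ = let D∈F , x̄∈D = Side⁻ D∈ in main-resolves F-mu M D∈F x̄∈D

    Side! : Unique Side
    Side! = Unique.filter⁺ clauseSetoid (λ D → comp x ∈? lits D) (distinct-! F)

    Rest! : Unique Rest
    Rest! = Unique.filter⁺ clauseSetoid (avoids? v) (distinct-! F)

    before-≐ : before-DP ≐ᶜ F
    before-≐ = ⊆⊇⇒≐ᶜ to from
      where
      to : ∀ {D} → D ∈ᶜ before-DP → D ∈ᶜ F
      to D∈ with ∈ᶜ⇒∈ D∈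
      ... | D′ , here refl , D≈C = ∈ᶜ-resp (≈-sym D≈C) (mem M)
      ... | D′ , there p , D≈D′ = ∈ᶜ-resp (≈-sym D≈D′)
        (Sum.[ proj₁ ∘ Side⁻ , proj₁ ∘ Rest⁻ ] (∈-++⁻ Side p))
      from : ∀ {D} → D ∈ᶜ F → D ∈ᶜ before-DP
      from {D} D∈F with contains-or-avoids x D
      ... | inj₁ x∈D = ∈⇒∈ᶜ (here refl) (only M D∈F x∈D)
      ... | inj₂ (inj₁ x̄∈D) = let _ , p , D≈ = ∈ᶜ⇒∈ (Side⁺ D∈F x̄∈D) in ∈⇒∈ᶜ (there (∈-++⁺ˡ p)) D≈
      ... | inj₂ (inj₂ D₀)  = let _ , p , D≈ = ∈ᶜ⇒∈ (Rest⁺ D∈F D₀) in ∈⇒∈ᶜ (there (∈-++⁺ʳ Side p)) D≈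

    after-≐ : after-DP ≐ᶜ DP v F
    after-≐ = ⊆⊇⇒≐ᶜ to from
      where
      to : ∀ {R} → R ∈ᶜ after-DP → R ∈ᶜ DP v F
      to R∈ with ∈ᶜ⇒∈ R∈
      ... | R′ , R′∈ , R≈R′ with ∈-++⁻ (map (resolventOn x C) Side) R′∈
      ...   | inj₂ p = let R′∈F , R′₀ = Rest⁻ p in ∈ᶜ-resp (≈-sym R≈R′) (DP-kept R′∈F R′₀)
      ...   | inj₁ p with ∈-map⁻ (resolventOn x C) p
      ...     | D , D∈ , refl =
        ∈ᶜ-resp (≈-sym R≈R′) (DP-resolvent (mem M) (proj₁ (Side⁻ D∈)) (Side-resolves D∈))
      from : ∀ {R} → R ∈ᶜ DP v F → R ∈ᶜ after-DP
      from R∈ with DP-main⁻ M R∈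
      ... | inj₁ (R∈F , R₀) = let _ , p , R≈ = ∈ᶜ⇒∈ (Rest⁺ R∈F R₀) in
        ∈⇒∈ᶜ (∈-++⁺ʳ (map (resolventOn x C) Side) p) R≈
      ... | inj₂ (D , D∈F , r) = let D′ , p , D≈ = ∈ᶜ⇒∈ (Side⁺ D∈F (right r)) in
        ∈⇒∈ᶜ (∈-++⁺ˡ (∈-map⁺ (resolventOn x C) p))
          (Resolves-unique (Resolves-resp ≈-refl D≈ ≈-refl r) (Side-resolves p))

    before-! : Unique before-DP
    before-! = All.tabulate C-new ∷ Unique.++⁺ clauseSetoid Side! Rest! (λ {D} → disjoint {D})
      where
      C-new : ∀ {D} → D ∈ₚ Side ++ Rest → ¬ lits C ≐ lits D
      C-new D∈ C≐D with ∈-++⁻ Side D∈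
      ... | inj₁ p = consistent C (has M) (rhs≤lhs C≐D (proj₂ (Side⁻ p)))
      ... | inj₂ p = ≢-var (proj₂ (Rest⁻ p)) (lhs≤rhs C≐D (has M)) refl
      disjoint : ∀ {D} → ¬ (D ClauseFinSet.∈ Side × D ClauseFinSet.∈ Rest)
      disjoint {D} (p , q) with find p | find q
      ... | E , E∈ , D≐E | E′ , E′∈ , D≐E′ =
        ≢-var (proj₂ (Rest⁻ E′∈)) (lhs≤rhs D≐E′ (rhs≤lhs D≐E (proj₂ (Side⁻ E∈)))) refl

    -- Elimination could in general merge clauses. Here `resolvent≈⇒side≈` keeps the resolvents
    -- apart from each other, and `resolvent-fresh` keeps them apart from the kept clauses.
    after-! : Unique after-DP
    after-! = Unique.++⁺ clauseSetoid (map! Side! Side-resolves (proj₁ ∘ Side⁻)) Rest! (λ {R} → disjoint {R})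
      where
      map! : ∀ {L} → Unique L → (∀ {D} → D ∈ₚ L → Resolves x C D (resolventOn x C D)) →
             (∀ {D} → D ∈ₚ L → D ∈ᶜ F) → Unique (map (resolventOn x C) L)
      map! []         _ _ = []
      map! {D ∷ L} (D∉L ∷ L!) res mem = All.tabulate new ∷ map! L! (res ∘ there) (mem ∘ there)
        where
        new : ∀ {R} → R ∈ₚ map (resolventOn x C) L → ¬ lits (resolventOn x C D) ≐ lits R
        new R∈ D≐R with ∈-map⁻ (resolventOn x C) R∈
        ... | E , E∈ , refl = All.lookup D∉L E∈ (lits≐
          (resolvent≈⇒side≈ F-mu M (mem (here refl)) (mem (there E∈))
            (res (here refl)) (res (there E∈)) (equal D≐R)))
      disjoint : ∀ {R} → ¬ (R ClauseFinSet.∈ map (resolventOn x C) Side × R ClauseFinSet.∈ Rest)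
      disjoint {P} (p , q) with find p | find q
      ... | R , R∈ , D≐R | E , E∈ , D≐E with ∈-map⁻ (resolventOn x C) R∈
      ...   | D , D∈ , refl = resolvent-fresh F-mu M (proj₁ (Side⁻ D∈)) (Side-resolves D∈)
        (∈ᶜ-resp (≈-trans (≈-sym (equal {P} D≐E)) (equal D≐R)) (proj₁ (Rest⁻ E∈)))

    length-Side : length Side ≡ degree F (comp x)
    length-Side = trans (sym (ldeg-distinct F (comp x))) (sym (degree≡ldeg F (comp x)))

  degrees : ∀ {y} → proj₁ y ≢ v → Degrees x C F y
  degrees {y} y≢v = record
    { sides  = count y Side
    ; others = count y Rest
    ; sides≤ = subst (count y Side ≤_) length-Side (length-filter (λ D → y ∈? lits D) Side)
    ; main∋ = λ y∈C →
        trans degF (trans (count-∋ C (Side ++ Rest) y∈C) (cong suc (count-++ y Side Rest))) ,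
        trans degH (cong (_+ count y Rest) (trans
          (cong length (filter-all (λ D → y ∈? lits D)
            (All.tabulate λ R∈ → all∋ y∈C (∈-map⁻ (resolventOn x C) R∈))))
          (trans (length-map (resolventOn x C) Side) length-Side)))
    ; main∌ = λ y∉C →
        trans degF (trans (count-∌ C (Side ++ Rest) y∉C) (count-++ y Side Rest)) ,
        trans degH (cong (_+ count y Rest) (count-map (All.tabulate λ D∈ →
          let r = Side-resolves D∈ in
          (λ y∈D → fromʳ r y∈D y≢v) ,
          (λ y∈R → Sum.[ (λ y∈C → contradiction y∈C y∉C) , id ] (origin r y∈R)))))
    }
    where
    degF : degree F y ≡ count y before-DP
    degF = trans (degree≡ldeg F y) (ldeg-unique {F = F} y before-! before-≐)
    degH : degree (DP v F) y ≡ count y (map (resolventOn x C) Side) + count y Rest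
    degH = trans (degree≡ldeg (DP v F) y)
      (trans (ldeg-unique {F = DP v F} y after-! after-≐) (count-++ y (map (resolventOn x C) Side) Rest))
    all∋ : y ∈ lits C → ∀ {R} → (∃ λ D → D ∈ₚ Side × R ≡ resolventOn x C D) → y ∈ lits R
    all∋ y∈C (D , D∈ , refl) = fromˡ (Side-resolves D∈) y∈C y≢v

-- An m-singular variable together with the sign that occurs once; as that sign contributes 1 to the
-- variable degree, m is the degree of the other sign.
record SingularAt (F : ClauseSet) (x : Literal) (m : ℕ) : Set where
  constructor singularAt
  field
    once        : degree F x ≡ 1
    degree-comp : degree F (comp x) ≡ m
    comp≥1      : 1 ≤ m

open SingularAt

opaque
  unfolding degree

  vdeg≡ : ∀ F x → vdeg F (proj₁ x) ≡ degree F x + degree F (comp x)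
  vdeg≡ F (pos v) = refl
  vdeg≡ F (neg v) = +-comm (ldeg F (pos v)) (ldeg F (neg v))

  min≡ : ∀ F x → ldeg F (pos (proj₁ x)) ⊓ ldeg F (neg (proj₁ x)) ≡ degree F x ⊓ degree F (comp x)
  min≡ F (pos v) = refl
  min≡ F (neg v) = ⊓-comm (ldeg F (pos v)) (ldeg F (neg v))

SingularAt⇒Singular : ∀ {F x m} → SingularAt F x m → Singular F (proj₁ x)
SingularAt⇒Singular {F} {x} (singularAt o c m≥1) =
  trans (min≡ F x) (trans (m≤n⇒m⊓n≡m (subst₂ _≤_ (sym o) (sym c) m≥1)) o)

SingularAt⇒vdeg : ∀ {F x m} → SingularAt F x m → vdeg F (proj₁ x) ∸ 1 ≡ m
SingularAt⇒vdeg {F} {x} (singularAt o c _) = cong (_∸ 1) (trans (vdeg≡ F x) (cong₂ _+_ o c))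

Singular⇒SingularAt : ∀ F v → Singular F v → ∃ λ b → SingularAt F (v , b) (vdeg F v ∸ 1)
Singular⇒SingularAt F v s =
  Sum.[ (λ e → true  , at (pos v) (trans (sym e) min≡1) (≤-trans 1≤min (m⊓n≤n (degree F (pos v)) _)))
      , (λ e → false , at (neg v) (trans (sym e) min≡1) (≤-trans 1≤min (m⊓n≤m (degree F (pos v)) _))) ]′
      (⊓-sel (degree F (pos v)) (degree F (neg v)))
  where
  min≡1 : degree F (pos v) ⊓ degree F (neg v) ≡ 1
  min≡1 = trans (sym (min≡ F (pos v))) s
  1≤min : 1 ≤ degree F (pos v) ⊓ degree F (neg v)
  1≤min = ≤-reflexive (sym min≡1)
  at : ∀ x → degree F x ≡ 1 → 1 ≤ degree F (comp x) → SingularAt F x (vdeg F (proj₁ x) ∸ 1)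
  at x o c = singularAt o (sym m≡) (subst (1 ≤_) (sym m≡) c)
    where
    m≡ : vdeg F (proj₁ x) ∸ 1 ≡ degree F (comp x)
    m≡ = SingularAt⇒vdeg (singularAt o refl c)

vdeg≤ : ∀ {F G} x → degree F x ≤ degree G x → degree F (comp x) ≤ degree G (comp x) →
        vdeg F (proj₁ x) ≤ vdeg G (proj₁ x)
vdeg≤ {F} {G} x p q = subst₂ _≤_ (sym (vdeg≡ F x)) (sym (vdeg≡ G x)) (+-mono-≤ p q)

Singular⇒Main : ∀ F v → Singular F v → ∃ λ b → ∃ λ C → Main (v , b) C F
Singular⇒Main F v s = let b , sing = Singular⇒SingularAt F v s in b , degree≡1⇒Main F (v , b) (once sing)

DP-avoids : ∀ v F {R} → R ∈ᶜ DP v F → R Avoids v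
DP-avoids v F R∈ with DP⁻ {v} {F} R∈
... | inj₁ (_ , R₀) = R₀
... | inj₂ (_ , _ , _ , _ , r) = avoids r

-- A singular variable occurs in some clause, but v occurs in no clause of `DP v F`. Hence adjacent
-- entries of a singular tuple differ.
DP-singular-≢ : ∀ v w F → Singular (DP v F) w → w ≢ v
DP-singular-≢ v w F s =
  let _ , _ , M = Singular⇒Main (DP v F) w s in ≢-var (DP-avoids v F (mem M)) (has M)

DP-singularAt-≢ : ∀ (x : Literal) F {y m} → SingularAt (DP (proj₁ x) F) y m → proj₁ y ≢ proj₁ x
DP-singularAt-≢ x F {y} Y = DP-singular-≢ (proj₁ x) (proj₁ y) F (SingularAt⇒Singular Y)

module DegreeChange {F x C} (F-mu : MinimallyUnsatisfiable F) (M : Main x C F)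
                    {y : Literal} (y≢v : proj₁ y ≢ proj₁ x) where

  private H = DP (proj₁ x) F

  open Degrees (degrees F-mu M {y} y≢v)

  main? : y ∈ lits C ⊎ y ∉ lits C
  main? = toSum (y ∈? lits C)

  unchanged : y ∉ lits C → degree F y ≡ degree H y
  unchanged y∉C = trans (proj₁ (main∌ y∉C)) (sym (proj₂ (main∌ y∉C)))

  multiplied : y ∈ lits C → degree F (comp x) ≤ degree H y
  multiplied y∈C = subst (degree F (comp x) ≤_) (sym (proj₂ (main∋ y∈C))) (m≤m+n _ others)

  -- Only C itself can be lost, because `sides` is at most the number of resolvents. Both the bound
  -- n + 1 and the bound m - 1 of the theorem come from here.
  loses≤1 : degree F y ≤ suc (degree H y)
  loses≤1 = Sum.[ (λ y∈C → subst₂ _≤_ (sym (proj₁ (main∋ y∈C))) (cong suc (sym (proj₂ (main∋ y∈C))))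
                              (s≤s (+-monoˡ-≤ others sides≤)))
                , (λ y∉C → ≤-trans (≤-reflexive (unchanged y∉C)) (n≤1+n _)) ]′ main?

  persists : 1 ≤ degree H y → 1 ≤ degree F y
  persists h≥1 = Sum.[ (λ y∈C → subst (1 ≤_) (sym (proj₁ (main∋ y∈C))) (s≤s z≤n))
                     , (λ y∉C → subst (1 ≤_) (sym (unchanged y∉C)) h≥1) ]′ main?

  -- C is the single occurrence of y, so `others` is 0 and afterwards y occurs exactly in the
  -- resolvents.
  replaced : y ∈ lits C → degree F y ≡ 1 → degree H y ≡ degree F (comp x)
  replaced y∈C f≡1 = trans (proj₂ (main∋ y∈C))
    (trans (cong (degree F (comp x) +_)
             (m+n≡0⇒n≡0 sides (cong (_∸ 1) (trans (sym (proj₁ (main∋ y∈C))) f≡1))))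
           (+-identityʳ _))

  -- The single resolvent takes the place of C, and an occurrence of y on the side is merged into
  -- it.
  shrinks : degree F (comp x) ≡ 1 → degree H y ≤ degree F y
  shrinks n≡1 = Sum.[ (λ y∈C → subst₂ _≤_ (sym (trans (proj₂ (main∋ y∈C)) (cong (_+ others) n≡1)))
                                  (sym (proj₁ (main∋ y∈C))) (s≤s (m≤n+m others sides)))
                    , (λ y∉C → ≤-reflexive (sym (unchanged y∉C))) ]′ main?

-- Degrees when two successive eliminations are exchanged

1≤n≤2 : ∀ {n} → 1 ≤ n → n ≤ 2 → n ≡ 1 ⊎ n ≡ 2
1≤n≤2 (s≤s _) (s≤s z≤n)       = inj₁ refl
1≤n≤2 (s≤s _) (s≤s (s≤s z≤n)) = inj₂ refl

module _ {F : ClauseSet} {x y : Literal} (F-mu : MinimallyUnsatisfiable F) where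

  private
    H = DP (proj₁ x) F
    K = DP (proj₁ y) F

  -- A literal of C has degree at least m ≥ 2 in H, so y is outside C and occurs once in F already,
  -- with the same sign. Its clause E is not C, so x is outside E and keeps degree 1 in K. The
  -- bounds then concern the two complements only.
  exchange-many : ∀ {m n} → SingularAt F x m → SingularAt H y n → m ≥ 2 →
    ∃₂ λ n′ m′ → SingularAt F y n′ × SingularAt K x m′ ×
      n′ ≤ n + 1 × m′ ≥ m ∸ 1 × (n ≡ 1 → n′ ≡ 1) × (n ≥ 2 → m′ ≥ 2)
  exchange-many {m} {n} X Y m≥2 = degree F ȳ , degree K x̄
    , singularAt y≡1 refl (F.persists {ȳ} w≢v (subst (1 ≤_) (sym (degree-comp Y)) (comp≥1 Y)))
    , singularAt (trans (sym (K.unchanged {x} v≢w x∉E)) (once X)) refl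
                 (≤-trans (∸-monoˡ-≤ 1 m≥2) m∸1≤)
    , ≤-trans (F.loses≤1 {ȳ} w≢v) (≤-reflexive (trans (cong suc (degree-comp Y)) (+-comm 1 n)))
    , m∸1≤
    , (λ n≡1 → trans (F.unchanged {ȳ} w≢v (ȳ∉C-of n≡1)) (trans (degree-comp Y) n≡1))
    , m′≥2
    where
    x̄ = comp x
    ȳ = comp y
    w≢v : proj₁ y ≢ proj₁ x
    w≢v = DP-singularAt-≢ x F Y
    v≢w = ≢-sym w≢v
    C = proj₁ (degree≡1⇒Main F x (once X))
    M : Main x C F
    M = proj₂ (degree≡1⇒Main F x (once X))
    module F {y} (p : proj₁ y ≢ proj₁ x) = DegreeChange {F} {x} {C} F-mu M {y} p
    big : ∀ {z} → proj₁ z ≢ proj₁ x → z ∈ lits C → m ≤ degree H z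
    big {z} p z∈C = subst (_≤ degree H z) (degree-comp X) (F.multiplied p z∈C)
    2≰1 : ¬ 2 ≤ 1
    2≰1 (s≤s ())
    y∉C : y ∉ lits C
    y∉C y∈C = 2≰1 (≤-trans m≥2 (subst (m ≤_) (once Y) (big w≢v y∈C)))
    ȳ∉C-of : n ≡ 1 → ȳ ∉ lits C
    ȳ∉C-of n≡1 ȳ∈C = 2≰1 (≤-trans m≥2 (subst (m ≤_) (trans (degree-comp Y) n≡1) (big w≢v ȳ∈C)))
    y≡1 : degree F y ≡ 1
    y≡1 = trans (F.unchanged w≢v y∉C) (once Y)
    E = proj₁ (degree≡1⇒Main F y y≡1)
    N : Main y E F
    N = proj₂ (degree≡1⇒Main F y y≡1)
    module K {x} (p : proj₁ x ≢ proj₁ y) = DegreeChange {F} {y} {E} F-mu N {x} p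
    x∉E : x ∉ lits E
    x∉E x∈E = y∉C (⟶ (only M (mem N) x∈E) (has N))
    m∸1≤ : m ∸ 1 ≤ degree K x̄
    m∸1≤ = ∸-monoˡ-≤ 1 (subst (_≤ suc (degree K x̄)) (degree-comp X) (K.loses≤1 {x̄} v≢w))
    m′≥2 : n ≥ 2 → degree K x̄ ≥ 2
    m′≥2 n≥2 =
      Sum.[ in-E
          , (λ x̄∉E → subst (2 ≤_) (trans (sym (degree-comp X)) (K.unchanged {x̄} v≢w x̄∉E)) m≥2) ]′
          (K.main? {x̄} v≢w)
      where
      in-E : x̄ ∈ lits E → degree K x̄ ≥ 2
      in-E x̄∈E = ≤-trans (subst (2 ≤_) (sym (trans (F.unchanged {ȳ} w≢v ȳ∉C) (degree-comp Y))) n≥2)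
                         (K.multiplied {x̄} v≢w x̄∈E)
        where
        -- C and E already clash in x, and E contains y, so `comp y` in C would be a second clash.
        ȳ∉C : ȳ ∉ lits C
        ȳ∉C ȳ∈C = w≢v (cong proj₁ (clash-only F-mu M (mem N) x̄∈E ȳ∈C
                    (subst (_∈ lits E) (sym (comp-involutive y)) (has N))))

  module _ (X : SingularAt F x 1) where

    private
      C = proj₁ (degree≡1⇒Main F x (once X))
      M : Main x C F
      M = proj₂ (degree≡1⇒Main F x (once X))
      D = proj₁ (degree≡1⇒Main F (comp x) (degree-comp X))
      M̄ : Main (comp x) D F
      M̄ = proj₂ (degree≡1⇒Main F (comp x) (degree-comp X))
      module F {y} (p : proj₁ y ≢ proj₁ x) = DegreeChange {F} {x} {C} F-mu M {y} p
      module F̄ {y} (p : proj₁ y ≢ proj₁ x) = DegreeChange {F} {comp x} {D} F-mu M̄ {y} p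

    vdeg-grows : proj₁ y ≢ proj₁ x → vdeg H (proj₁ y) ≤ vdeg F (proj₁ y)
    vdeg-grows w≢v = vdeg≤ {H} {F} y (F.shrinks w≢v (degree-comp X)) (F.shrinks w≢v (degree-comp X))

    -- If x lies in E, its degree becomes n; then `comp x` is outside E, keeps degree 1, and becomes
    -- the literal that occurs once. Otherwise x itself keeps degree 1.
    exchange-once-many : ∀ {n} → proj₁ y ≢ proj₁ x → SingularAt F y n → Singular K (proj₁ x)
    exchange-once-many {n} w≢v Y = Sum.[ in-E , not-in-E ]′ (K.main? {x} v≢w)
      where
      v≢w = ≢-sym w≢v
      E = proj₁ (degree≡1⇒Main F y (once Y))
      N : Main y E F
      N = proj₂ (degree≡1⇒Main F y (once Y))
      module K {x} (p : proj₁ x ≢ proj₁ y) = DegreeChange {F} {y} {E} F-mu N {x} p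
      in-E : x ∈ lits E → Singular K (proj₁ x)
      in-E x∈E = SingularAt⇒Singular {x = comp x} {n} (singularAt
          (trans (sym (K.unchanged {comp x} v≢w (consistent E x∈E))) (degree-comp X))
          (trans (cong (degree K) (comp-involutive x))
                 (trans (K.replaced {x} v≢w x∈E (once X)) (degree-comp Y)))
          (comp≥1 Y))
      not-in-E : x ∉ lits E → Singular K (proj₁ x)
      not-in-E x∉E = SingularAt⇒Singular {x = x} (singularAt
          (trans (sym (K.unchanged {x} v≢w x∉E)) (once X)) refl x̄≥1)
        where
        x̄≥1 : 1 ≤ degree K (comp x)
        x̄≥1 =
          Sum.[ (λ x̄∈E → subst (1 ≤_)
                  (sym (trans (K.replaced {comp x} v≢w x̄∈E (degree-comp X)) (degree-comp Y))) (comp≥1 Y))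
              , (λ x̄∉E → ≤-reflexive (trans (sym (degree-comp X)) (K.unchanged {comp x} v≢w x̄∉E))) ]′
              (K.main? {comp x} v≢w)

    -- Since x and `comp x` both have degree 1, either of C and D can serve as the main clause, and
    -- a literal missing from the chosen one keeps its degree.
    both-or-unchanged : proj₁ y ≢ proj₁ x → (y ∈ lits C × y ∈ lits D) ⊎ degree F y ≡ degree H y
    both-or-unchanged w≢v =
      Sum.[ (λ y∈C → Sum.map (y∈C ,_) (F̄.unchanged w≢v) (F̄.main? w≢v)) , inj₂ ∘ F.unchanged w≢v ]′
          (F.main? w≢v)

module _ {F : ClauseSet} {x y : Literal} (F-mu : MinimallyUnsatisfiable F) (X : SingularAt F x 1) where

  private
    H = DP (proj₁ x) F
    K = DP (proj₁ y) F

  -- If `comp y` has degree 2 in F, it lies in both C and D; then y is in neither, so E contains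
  -- neither x nor `comp x` and their degrees stay 1. If it has degree 1, then E is replaced by one
  -- resolvent and again they stay 1.
  exchange-once-at : SingularAt H y 1 → degree F y ≡ 1 →
    ∃ λ n′ → SingularAt F y n′ × SingularAt K x 1 × (n′ ≡ 1 ⊎ n′ ≡ 2)
  exchange-once-at Y y≡1 = degree F ȳ , singularAt y≡1 refl ȳ≥1
    , singularAt
        (K≡1 {x} v≢w (once X) λ n′≡2 x∈E → y∉C n′≡2 (⟶ (only M (mem N) x∈E) (has N)))
        (K≡1 {comp x} v≢w (degree-comp X) λ n′≡2 x̄∈E → y∉D n′≡2 (⟶ (only M̄ (mem N) x̄∈E) (has N)))
        ≤-refl
    , n′≡
    where
    ȳ = comp y
    w≢v : proj₁ y ≢ proj₁ x
    w≢v = DP-singularAt-≢ x F Y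
    v≢w = ≢-sym w≢v
    C = proj₁ (degree≡1⇒Main F x (once X))
    M : Main x C F
    M = proj₂ (degree≡1⇒Main F x (once X))
    D = proj₁ (degree≡1⇒Main F (comp x) (degree-comp X))
    M̄ : Main (comp x) D F
    M̄ = proj₂ (degree≡1⇒Main F (comp x) (degree-comp X))
    E = proj₁ (degree≡1⇒Main F y y≡1)
    N : Main y E F
    N = proj₂ (degree≡1⇒Main F y y≡1)
    module F = DegreeChange {F} {x} {C} F-mu M {ȳ} w≢v
    ȳ≥1 : 1 ≤ degree F ȳ
    ȳ≥1 = F.persists (≤-reflexive (sym (degree-comp Y)))
    n′≡ : degree F ȳ ≡ 1 ⊎ degree F ȳ ≡ 2
    n′≡ = 1≤n≤2 ȳ≥1 (subst (λ h → degree F ȳ ≤ suc h) (degree-comp Y) F.loses≤1)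
    ȳ∈both : degree F ȳ ≡ 2 → ȳ ∈ lits C × ȳ ∈ lits D
    ȳ∈both n′≡2 = Sum.[ id , (λ same → contradiction (trans (sym n′≡2) (trans same (degree-comp Y))) λ ()) ]′
                    (both-or-unchanged {F} {x} {ȳ} F-mu X w≢v)
    y∉C : degree F ȳ ≡ 2 → y ∉ lits C
    y∉C n′≡2 y∈C = consistent C y∈C (proj₁ (ȳ∈both n′≡2))
    y∉D : degree F ȳ ≡ 2 → y ∉ lits D
    y∉D n′≡2 y∈D = consistent D y∈D (proj₂ (ȳ∈both n′≡2))
    K≡1 : ∀ {z} → proj₁ z ≢ proj₁ y → degree F z ≡ 1 → (degree F ȳ ≡ 2 → z ∉ lits E) → degree K z ≡ 1
    K≡1 {z} z≢w z≡1 z∉E = Sum.[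
        (λ z∈E → trans (K.replaced z∈E z≡1) (Sum.[ id , (λ n′≡2 → contradiction z∈E (z∉E n′≡2)) ]′ n′≡))
      , (λ z∉E′ → trans (sym (K.unchanged z∉E′)) z≡1) ]′ K.main?
      where module K = DegreeChange {F} {y} {E} F-mu N {z} z≢w

-- Both signs of the second variable occur once in H, and at least one of them already does so in F;
-- `t` records which.
exchange-once : ∀ {F : ClauseSet} {x y : Literal} → MinimallyUnsatisfiable F →
  SingularAt F x 1 → SingularAt (DP (proj₁ x) F) y 1 →
  ∃₂ λ t n′ → SingularAt F (proj₁ y , t) n′ × SingularAt (DP (proj₁ y) F) x 1 × (n′ ≡ 1 ⊎ n′ ≡ 2)
exchange-once {F} {x} {y} F-mu X Y =
  Sum.[ both , (λ same → proj₂ y , exchange-once-at {F} {x} {y} F-mu X Y (trans same (once Y))) ]′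
      (both-or-unchanged {F} {x} {y} F-mu X (DP-singularAt-≢ x F Y))
  where
  C = proj₁ (degree≡1⇒Main F x (once X))
  M : Main x C F
  M = proj₂ (degree≡1⇒Main F x (once X))
  Ȳ : SingularAt (DP (proj₁ x) F) (comp y) 1
  Ȳ = singularAt (degree-comp Y) (trans (cong (degree (DP (proj₁ x) F)) (comp-involutive y)) (once Y)) ≤-refl
  -- C cannot contain comp y as well, so comp y takes the role of y.
  both : y ∈ lits C × _ → _
  both (y∈C , _) = proj₂ (comp y) , exchange-once-at {F} {x} {comp y} F-mu X Ȳ (trans ȳ-unchanged (degree-comp Y))
    where
    ȳ-unchanged : degree F (comp y) ≡ degree (DP (proj₁ x) F) (comp y)
    ȳ-unchanged = DegreeChange.unchanged {F} {x} {C} F-mu M {comp y} (DP-singularAt-≢ x F Y) (consistent C y∈C)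

-- Swapping two adjacent entries of a singular tuple

Singular-cong : ∀ F G v → F ≐ᶜ G → Singular F v → Singular G v
Singular-cong F G v F≐G =
  trans (sym (cong₂ _⊓_ (ldeg-cong {F} {G} (pos v) F≐G) (ldeg-cong {F} {G} (neg v) F≐G)))

vdeg-cong : ∀ F G v → F ≐ᶜ G → vdeg F v ≡ vdeg G v
vdeg-cong F G v F≐G = cong₂ _+_ (ldeg-cong {F} {G} (pos v) F≐G) (ldeg-cong {F} {G} (neg v) F≐G)

DP*-cong : ∀ vs F G → F ≐ᶜ G → DP* vs F ≐ᶜ DP* vs G
DP*-cong []       F G F≐G = F≐G
DP*-cong (v ∷ vs) F G F≐G = DP*-cong vs (DP v F) (DP v G) (DP-cong {v} {F} {G} F≐G)

DP-singular-comm : ∀ F a b → a ≢ b → Singular F a → Singular F b → DP b (DP a F) ≐ᶜ DP a (DP b F)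
DP-singular-comm F a b a≢b A B =
  let s , _ , M = Singular⇒Main F a A
      t , _ , N = Singular⇒Main F b B
  in DP-comm {a , s} {b , t} {F} a≢b M N

DP-singular-minimallyUnsatisfiable :
  ∀ F a → MinimallyUnsatisfiable F → Singular F a → MinimallyUnsatisfiable (DP a F)
DP-singular-minimallyUnsatisfiable F a F-mu A =
  let s , _ , M = Singular⇒Main F a A in DP-minimallyUnsatisfiable {F} {a , s} F-mu M

module _ (F : ClauseSet) (a b : Var) (F-mu : MinimallyUnsatisfiable F)
         (A : Singular F a) (B : Singular (DP a F) b) where

  private
    m = vdeg F a ∸ 1
    n = vdeg (DP a F) b ∸ 1
    n′ = vdeg F b ∸ 1
    m′ = vdeg (DP b F) a ∸ 1

    swap-many-at : ∀ s t → SingularAt F (a , s) m → SingularAt (DP a F) (b , t) n → m ≥ 2 →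
      Singular F b × Singular (DP b F) a ×
      n′ ≤ n + 1 × m′ ≥ m ∸ 1 × (n ≡ 1 → n′ ≡ 1) × (n ≥ 2 → m′ ≥ 2)
    swap-many-at s t X Y m≥2 =
      let p , q , Y′ , X′ , c₁ , c₂ , c₃ , c₄ = exchange-many {F} {a , s} {b , t} F-mu X Y m≥2
          p≡ = sym (SingularAt⇒vdeg {F} {b , t} Y′)
          q≡ = sym (SingularAt⇒vdeg {DP b F} {a , s} X′)
      in SingularAt⇒Singular {F} {b , t} Y′ , SingularAt⇒Singular {DP b F} {a , s} X′
       , subst (_≤ n + 1) p≡ c₁ , subst (_≥ m ∸ 1) q≡ c₂
       , (λ n≡1 → trans (sym p≡) (c₃ n≡1)) , (λ n≥2 → subst (_≥ 2) q≡ (c₄ n≥2))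

    swap-once-once-at : ∀ s t → SingularAt F (a , s) 1 → SingularAt (DP a F) (b , t) 1 →
      Singular F b × Singular (DP b F) a × m′ ≡ 1 × (n′ ≡ 1 ⊎ n′ ≡ 2)
    swap-once-once-at s t X Y =
      let t′ , _ , Y′ , X′ , n′≡ = exchange-once {F} {a , s} {b , t} F-mu X Y
          p≡ = SingularAt⇒vdeg {F} {b , t′} Y′
      in SingularAt⇒Singular {F} {b , t′} Y′ , SingularAt⇒Singular {DP b F} {a , s} X′
       , SingularAt⇒vdeg {DP b F} {a , s} X′ , Sum.map (trans p≡) (trans p≡) n′≡

    swap-once-many-at : ∀ s → SingularAt F (a , s) 1 → n ≥ 2 → n′ ≥ 2 × (Singular F b → Singular (DP b F) a)
    swap-once-many-at s X n≥2 =
        ≤-trans n≥2 (∸-monoˡ-≤ 1 (vdeg-grows {F} {a , s} {b , true} F-mu X b≢a))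
      , λ B′ → let t , Y′ = Singular⇒SingularAt F b B′ in exchange-once-many {F} {a , s} {b , t} F-mu X b≢a Y′
      where
      b≢a : b ≢ a
      b≢a = DP-singular-≢ a b F B

  swap-many : m ≥ 2 → Singular F b × Singular (DP b F) a ×
    n′ ≤ n + 1 × m′ ≥ m ∸ 1 × (n ≡ 1 → n′ ≡ 1) × (n ≥ 2 → m′ ≥ 2)
  swap-many =
    let s , X = Singular⇒SingularAt F a A
        t , Y = Singular⇒SingularAt (DP a F) b B
    in swap-many-at s t X Y

  swap-once-once : m ≡ 1 → n ≡ 1 → Singular F b × Singular (DP b F) a × m′ ≡ 1 × (n′ ≡ 1 ⊎ n′ ≡ 2)
  swap-once-once m≡1 n≡1 =
    let s , X = Singular⇒SingularAt F a A
        t , Y = Singular⇒SingularAt (DP a F) b B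
    in swap-once-once-at s t (subst (SingularAt F (a , s)) m≡1 X) (subst (SingularAt (DP a F) (b , t)) n≡1 Y)

  swap-once-many : m ≡ 1 → n ≥ 2 → n′ ≥ 2 × (Singular F b → Singular (DP b F) a)
  swap-once-many m≡1 = let s , X = Singular⇒SingularAt F a A in
    swap-once-many-at s (subst (SingularAt F (a , s)) m≡1 X)

-- Describes `v′` by its values, so that an induction on the position can pass to tails without
-- restricting a permutation.
record Swapped {k} (i : Fin k) (v v′ : Vector Var (suc k)) : Set where
  field
    at₀       : v′ (inject₁ i) ≡ v (suc i)
    at₁       : v′ (suc i) ≡ v (inject₁ i)
    elsewhere : ∀ j → j ≢ inject₁ i → j ≢ suc i → v′ j ≡ v j

open Swapped

inject₁≢suc : ∀ {k} (i : Fin k) → inject₁ i ≢ suc i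
inject₁≢suc (suc i) e = inject₁≢suc i (suc-injective e)

transpose-swapped : ∀ {k} (i : Fin k) (v : Vector Var (suc k)) →
                    Swapped i v (permute (transpose (inject₁ i) (suc i)) v)
transpose-swapped i v = record
  { at₀       = cong v first
  ; at₁       = cong v second
  ; elsewhere = λ j j≢i₀ j≢i₁ → cong v (other j j≢i₀ j≢i₁)
  }
  where
  π = transpose (inject₁ i) (suc i)
  first : π ⟨$⟩ʳ inject₁ i ≡ suc i
  first rewrite dec-true (inject₁ i ≟ᶠ inject₁ i) refl = refl
  second : π ⟨$⟩ʳ suc i ≡ inject₁ i
  second rewrite dec-false (suc i ≟ᶠ inject₁ i) (inject₁≢suc i ∘ sym) | dec-true (suc i ≟ᶠ suc i) refl = refl
  other : ∀ j → j ≢ inject₁ i → j ≢ suc i → π ⟨$⟩ʳ j ≡ j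
  other j p q rewrite dec-false (j ≟ᶠ inject₁ i) p | dec-false (j ≟ᶠ suc i) q = refl

-- Keeps `v′` abstract instead of fixing it as a permuted tuple, so that the same formula serves as
-- induction hypothesis for the tails.
Conclusion : ∀ {k} → ClauseSet → Vector Var (suc k) → Vector ℕ (suc k) → Fin k →
             Vector Var (suc k) → Vector ℕ (suc k) → Set
Conclusion F v m i v′ m′ =
    (SingularTuple F v′ → ∀ j → j ≢ i₀ → j ≢ i₁ → m′ j ≡ m j)
    ×
    (m i₀ ≥ 2 →
      SingularTuple F v′
      × m′ i₀ ≤ m i₁ + 1
      × m′ i₁ ≥ m i₀ ∸ 1
      × (m i₁ ≡ 1 → m′ i₀ ≡ 1)
      × (m i₁ ≥ 2 → m′ i₁ ≥ 2))
    ×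
    (m i₀ ≡ 1 →
      (m i₁ ≡ 1 →
        SingularTuple F v′
        × m′ i₁ ≡ 1
        × (m′ i₀ ≡ 1 ⊎ m′ i₀ ≡ 2))
      ×
      (m i₁ ≥ 2 →
        (SingularTuple F v′ ⇔ Singular (DP* (before v i₀) F) (v i₁))
        × (SingularTuple F v′ → m′ i₀ ≥ 2)))
  where
  i₀ = inject₁ i
  i₁ = suc i

degree-at : ∀ {k} F (v : Vector Var k) m → SingularityDegrees F v m → ∀ j →
            m j ≡ vdeg (DP* (before v j) F) (v j) ∸ 1
degree-at F v m degs j = sym (proj₂ (proj₂ (degs j)))

module SwapHead {k} (F : ClauseSet) (v v′ : Vector Var (suc (suc k))) (m m′ : Vector ℕ (suc (suc k)))
  (F-mu : MinimallyUnsatisfiable F) (T : SingularTuple F v) (degs : SingularityDegrees F v m)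
  (swapped : Swapped zero v v′) (degs′ : SingularTuple F v′ → SingularityDegrees F v′ m′) where

  private
    a b : Var
    a = v zero
    b = v (suc zero)

    A : Singular F a
    A = T zero

    B : Singular (DP a F) b
    B = T (suc zero)

    m₀≡ : m zero ≡ vdeg F a ∸ 1
    m₀≡ = degree-at F v m degs zero

    m₁≡ : m (suc zero) ≡ vdeg (DP a F) b ∸ 1
    m₁≡ = degree-at F v m degs (suc zero)

    v′₀ : v′ zero ≡ b
    v′₀ = at₀ swapped

    v′₁ : v′ (suc zero) ≡ a
    v′₁ = at₁ swapped

    rest≗ : ∀ (j : Fin k) → v′ (suc (suc j)) ≡ v (suc (suc j))
    rest≗ j = elsewhere swapped (suc (suc j)) (λ ()) (λ ())

    heads : SingularTuple F v′ → Singular F b × Singular (DP b F) a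
    heads T′ = subst (Singular F) v′₀ (T′ zero)
             , subst₂ (λ p q → Singular (DP p F) q) v′₀ v′₁ (T′ (suc zero))

    -- Past the swapped pair both tuples eliminate the same variables, from clause-sets that are
    -- equal by commutation. This is why b has to be singular in F and not only in `DP a F`.
    reduct-≐ : Singular F b → ∀ j →
      DP* (before v (suc (suc j))) F ≐ᶜ DP* (before v′ (suc (suc j))) F
    reduct-≐ B′ j = subst₂ (λ p q → DP* (before v (suc (suc j))) F ≐ᶜ DP* q p)
        (cong₂ (λ p q → DP q (DP p F)) (sym v′₀) (sym v′₁))
        (cong (take (toℕ j)) (tabulate-cong (sym ∘ rest≗)))
        (DP*-cong (before (λ j → v (suc (suc j))) j) (DP b (DP a F)) (DP a (DP b F))
          (DP-singular-comm F a b (≢-sym (DP-singular-≢ a b F B)) A B′))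

    preserving : Singular F b → Singular (DP b F) a → SingularTuple F v′
    preserving B′ A′ zero          = subst (Singular F) (sym v′₀) B′
    preserving B′ A′ (suc zero)    = subst₂ (λ p q → Singular (DP p F) q) (sym v′₀) (sym v′₁) A′
    preserving B′ A′ (suc (suc j)) = subst (Singular (DP* (before v′ (suc (suc j))) F)) (sym (rest≗ j))
      (Singular-cong (DP* (before v (suc (suc j))) F) (DP* (before v′ (suc (suc j))) F) (v (suc (suc j)))
        (reduct-≐ B′ j) (T (suc (suc j))))

    m′₀≡ : SingularTuple F v′ → vdeg F b ∸ 1 ≡ m′ zero
    m′₀≡ T′ = trans (cong (λ p → vdeg F p ∸ 1) (sym v′₀)) (sym (degree-at F v′ m′ (degs′ T′) zero))

    m′₁≡ : SingularTuple F v′ → vdeg (DP b F) a ∸ 1 ≡ m′ (suc zero)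
    m′₁≡ T′ = trans (cong₂ (λ p q → vdeg (DP p F) q ∸ 1) (sym v′₀) (sym v′₁))
                    (sym (degree-at F v′ m′ (degs′ T′) (suc zero)))

    unaffected : SingularTuple F v′ → ∀ j → j ≢ zero → j ≢ suc zero → m′ j ≡ m j
    unaffected T′ zero          j≢0 _   = contradiction refl j≢0
    unaffected T′ (suc zero)    _   j≢1 = contradiction refl j≢1
    unaffected T′ (suc (suc j)) _   _   =
      trans (degree-at F v′ m′ (degs′ T′) (suc (suc j)))
        (trans (cong (λ u → vdeg (DP* (before v′ (suc (suc j))) F) u ∸ 1) (rest≗ j))
          (trans (cong (_∸ 1) (sym (vdeg-cong (DP* (before v (suc (suc j))) F) (DP* (before v′ (suc (suc j))) F)
                                     (v (suc (suc j))) (reduct-≐ (proj₁ (heads T′)) j))))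
            (sym (degree-at F v m degs (suc (suc j))))))

  conclusion : Conclusion F v m zero v′ m′
  conclusion = unaffected , many , λ m≡1 → once-once m≡1 , once-many m≡1
    where
    many : m zero ≥ 2 → SingularTuple F v′ × m′ zero ≤ m (suc zero) + 1 × m′ (suc zero) ≥ m zero ∸ 1 ×
           (m (suc zero) ≡ 1 → m′ zero ≡ 1) × (m (suc zero) ≥ 2 → m′ (suc zero) ≥ 2)
    many m≥2 =
      let B′ , A′ , c₁ , c₂ , c₃ , c₄ = swap-many F a b F-mu A B (subst (_≥ 2) m₀≡ m≥2)
          T′ = preserving B′ A′
      in T′
       , subst₂ (λ p q → p ≤ q + 1) (m′₀≡ T′) (sym m₁≡) c₁
       , subst₂ (λ p q → p ≥ q ∸ 1) (m′₁≡ T′) (sym m₀≡) c₂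
       , (λ n≡1 → trans (sym (m′₀≡ T′)) (c₃ (trans (sym m₁≡) n≡1)))
       , (λ n≥2 → subst (_≥ 2) (m′₁≡ T′) (c₄ (subst (_≥ 2) m₁≡ n≥2)))
    once-once : m zero ≡ 1 → m (suc zero) ≡ 1 →
                SingularTuple F v′ × m′ (suc zero) ≡ 1 × (m′ zero ≡ 1 ⊎ m′ zero ≡ 2)
    once-once m≡1 n≡1 =
      let B′ , A′ , c₁ , c₂ = swap-once-once F a b F-mu A B (trans (sym m₀≡) m≡1) (trans (sym m₁≡) n≡1)
          T′ = preserving B′ A′
      in T′ , trans (sym (m′₁≡ T′)) c₁ , Sum.map (trans (sym (m′₀≡ T′))) (trans (sym (m′₀≡ T′))) c₂
    once-many : m zero ≡ 1 → m (suc zero) ≥ 2 →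
                (SingularTuple F v′ ⇔ Singular F b) × (SingularTuple F v′ → m′ zero ≥ 2)
    once-many m≡1 n≥2 =
      let c₁ , c₂ = swap-once-many F a b F-mu A B (trans (sym m₀≡) m≡1) (subst (_≥ 2) m₁≡ n≥2)
      in mk⇔ (proj₁ ∘ heads) (λ B′ → preserving B′ (c₂ B′)) , (λ T′ → subst (_≥ 2) (m′₀≡ T′) c₁)

-- Induction on the position: a first entry before the pair is common to both tuples, and its
-- elimination leaves a minimally unsatisfiable clause-set for which the tails satisfy the same
-- hypotheses.
adjacent-swap : ∀ {k} F (v : Vector Var (suc k)) m → MinimallyUnsatisfiable F →
  SingularTuple F v → SingularityDegrees F v m → ∀ i v′ m′ → Swapped i v v′ →
  (SingularTuple F v′ → SingularityDegrees F v′ m′) → Conclusion F v m i v′ m′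
adjacent-swap F v m F-mu T degs zero v′ m′ swapped degs′ =
  SwapHead.conclusion F v v′ m m′ F-mu T degs swapped degs′
adjacent-swap {suc k} F v m F-mu T degs (suc i) v′ m′ swapped degs′ =
  let c₁ , c₂ , c₃ = ih in
    unaffected c₁
  , (λ m≥2 → Product.map₁ cons (c₂ m≥2))
  , (λ m≡1 → let d₁ , d₂ = c₃ m≡1 in
      (λ n≡1 → Product.map₁ cons (d₁ n≡1)) ,
      (λ n≥2 → let e , f = d₂ n≥2 in
        mk⇔ (Equivalence.to e ∘ uncons) (cons ∘ Equivalence.from e) , f ∘ uncons))
  where
  G = DP (v zero) F
  head≡ : v′ zero ≡ v zero
  head≡ = elsewhere swapped zero (λ ()) (λ ())
  uncons : SingularTuple F v′ → SingularTuple G (tail v′)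
  uncons T′ = subst (λ u → SingularTuple (DP u F) (tail v′)) head≡ (λ j → T′ (suc j))
  cons : SingularTuple G (tail v′) → SingularTuple F v′
  cons T′ zero    = subst (Singular F) (sym head≡) (T zero)
  cons T′ (suc j) = subst (λ u → SingularTuple (DP u F) (tail v′)) (sym head≡) T′ j
  ih : Conclusion G (tail v) (tail m) i (tail v′) (tail m′)
  ih = adjacent-swap G (tail v) (tail m) (DP-singular-minimallyUnsatisfiable F (v zero) F-mu (T zero))
    (λ j → T (suc j)) (λ j → degs (suc j)) i (tail v′) (tail m′)
    (record
      { at₀ = at₀ swapped
      ; at₁ = at₁ swapped
      ; elsewhere = λ j p q → elsewhere swapped (suc j) (p ∘ suc-injective) (q ∘ suc-injective)
      })
    (λ T′ → subst (λ u → SingularityDegrees (DP u F) (tail v′) (tail m′)) head≡ (λ j → degs′ (cons T′) (suc j)))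
  unaffected : (SingularTuple G (tail v′) → ∀ j → j ≢ inject₁ i → j ≢ suc i → m′ (suc j) ≡ m (suc j)) →
    SingularTuple F v′ → ∀ j → j ≢ suc (inject₁ i) → j ≢ suc (suc i) → m′ j ≡ m j
  unaffected c T′ zero _ _ = trans (degree-at F v′ m′ (degs′ T′) zero)
    (trans (cong (λ u → vdeg F u ∸ 1) head≡) (sym (degree-at F v m degs zero)))
  unaffected c T′ (suc j) p q = c (uncons T′) j (p ∘ cong suc) (q ∘ cong suc)

theorem41 :
    ∀ {k} (F : ClauseSet) (v : Vector Var (suc k)) (m : Vector ℕ (suc k)) →
    MinimallyUnsatisfiable F →
    SingularTuple F v →
    SingularityDegrees F v m →
    (i : Fin k) →
    let i₀ = inject₁ i
        i₁ = suc i
        π  = transpose i₀ i₁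
        v′ = permute π v
    in
    (m′ : Vector ℕ (suc k)) →
    (SingularTuple F v′ → SingularityDegrees F v′ m′) →
    (SingularityPreserving F v π → ∀ j → j ≢ i₀ → j ≢ i₁ → m′ j ≡ m j)
    ×
    (m i₀ ≥ 2 →
      SingularityPreserving F v π
      × m′ i₀ ≤ m i₁ + 1
      × m′ i₁ ≥ m i₀ ∸ 1
      × (m i₁ ≡ 1 → m′ i₀ ≡ 1)
      × (m i₁ ≥ 2 → m′ i₁ ≥ 2))
    ×
    (m i₀ ≡ 1 →
      (m i₁ ≡ 1 →
        SingularityPreserving F v π
        × m′ i₁ ≡ 1
        × (m′ i₀ ≡ 1 ⊎ m′ i₀ ≡ 2))
      ×
      (m i₁ ≥ 2 →
        (SingularityPreserving F v π ⇔ Singular (DP* (before v i₀) F) (v i₁))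
        × (SingularityPreserving F v π → m′ i₀ ≥ 2)))
theorem41 F v m F-mu T degs i m′ degs′ =
  adjacent-swap F v m F-mu T degs i (permute (transpose (inject₁ i) (suc i)) v) m′ (transpose-swapped i v) degs′
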